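{- Let $P$ be an abstract proof system, let $t=(p_{\mathrm{fml}},\mathrm{prog})$ be a trace structure for $P$, and let $\gamma$ be an ordinal. If a pre-proof $c$ of $P$ is a proof (i.e. satisfies the global trace condition on $t$), then for every $F[P^\gamma]$-algebra $a'$ the pre-proof $c$ has a unique solution with respect to the $F[P]$-algebra $\mathrm{Alg}(u^\gamma_*)(a')$.
   Context: Presheaves and polynomials. For a small category $\mathbb{A}$, $\widehat{\mathbb{A}}=\mathbf{Set}^{\mathbb{A}^{\mathrm{op}}}$. For a functor $f\colon\mathbb{I}\to\mathbb{J}$ of small categories, $f^*=(-)\circ f^{\mathrm{op}}\colon\widehat{\mathbb{J}}\to\widehat{\mathbb{I}}$, with left adjoint $f_!$ and right adjoint $f_*$. A discrete fibration is a functor $t\colon\mathbb{E}\to\mathbb{B}$ such that each $b\to t(e)$ has a unique lift $e'\to e$. A two-sided discrete fibration is a pair $(s\colon\mathbb{I}\to\mathbb{A},q\colon\mathbb{I}\to\mathbb{B})$ such that: each $a\to s(i)$ has a unique lift $i'\to i$ which $q$ sends to $\mathrm{id}_{q(i)}$; each $q(i)\to b$ has a unique lift $i\to i'$ which $s$ sends to $\mathrm{id}_{s(i)}$; and for each $f\colon i\to j$ the domain of the lift of $s(f)$ equals the codomain of the lift of $q(f)$ and the composite of these lifts is $f$. A polynomial $(s,q,t)$ is a diagram of small categories $\mathbb{A}\xleftarrow{s}\mathbb{I}\xrightarrow{q}\mathbb{J}\xrightarrow{t}\mathbb{A}$ with $(s,q)$ a two-sided discrete fibration and $t$ a discrete fibration.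 Its familial functor is $F[P]=t_!q_*s^*\colon\widehat{\mathbb{A}}\to\widehat{\mathbb{A}}$; concretely $F[P](G)(a)\cong\coprod_{j\in\mathbb{J}_a}\lim_{i\in\mathbb{I}_j^{\mathrm{op}}}G(s(i))$, where $\mathbb{J}_a$ is the fibre of $t$ over $a$ and $\mathbb{I}_j$ the fibre of $q$ over $j$. A morphism of polynomials $(s',q',t')\to(s,q,t)$ (category $\mathbf{VPoly}$) is a triple of functors $u\colon\mathbb{A}'\to\mathbb{A}$, $u_1\colon\mathbb{I}'\to\mathbb{I}$, $u_2\colon\mathbb{J}'\to\mathbb{J}$ with $us'=su_1$, $u_2q'=qu_1$, $ut'=tu_2$, the last square being a pullback. It induces a canonical natural transformation $\tau\colon u^*F[P]\Rightarrow F[P']u^*$, $\tau_{X,a'}(j,\langle n_i\rangle_{i\in\mathbb{I}_j})=(j',\langle n_{u_1(i')}\rangle_{i'\in\mathbb{I}'_{j'}})$, where $j'$ is the unique object with $t'(j')=a'$, $u_2(j')=j$. Let $\sigma\colon F[P]u_*\Rightarrow u_*F[P']$ be its mate under $u^*\dashv u_*$. Put $\mathrm{Coalg}(u^*)(c)=\tau_C\circ u^*(c)$ for an $F[P]$-coalgebra $c\colon C\to F[P]C$, and $\mathrm{Alg}(u_*)(a')=u_*(a')\circ\sigma_A$ for an $F[P']$-algebra $a'\colon F[P']A\to A$. Proof systems. For $\mathrm{ar}\colon R\to\mathbf{Cat}$ ($\mathbf{Cat}$: small categories), $q_{\mathrm{ar}}\colon\int\mathrm{ar}\to R$ is the Grothendieck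 opfibration: objects are pairs $(r,i)$ with $i\in\mathrm{ar}(r)$ (also written $i\in\mathrm{ar}(r)$), morphisms $(r,i)\to(r',i')$ are pairs of $h\colon r\to r'$ and $\mathrm{ar}(h)(i)\to i'$. For a presheaf $X$ on a category, $p_X\colon\int X\to\cdot$ denotes its category of elements with projection. An abstract proof system $P=(\mathrm{prem},q_{\mathrm{ar}},\mathrm{ccl})$ consists of small categories $\mathrm{Jdg},R$ and functors $\mathrm{ar}\colon R\to\mathbf{Cat}$, $\mathrm{prem}\colon\int\mathrm{ar}\to\mathrm{Jdg}$, $\mathrm{ccl}\colon R\to\mathrm{Jdg}$ such that $\mathrm{Jdg}\xleftarrow{\mathrm{prem}}\int\mathrm{ar}\xrightarrow{q_{\mathrm{ar}}}R\xrightarrow{\mathrm{ccl}}\mathrm{Jdg}$ is a polynomial; it is used that $\mathrm{prem}(r_1,i)=\mathrm{prem}(r_2,\mathrm{ar}(h)(i))$ for $h\colon r_1\to r_2$. A pre-proof of $P$ is a coalgebra $c\colon C\to F[P](C)$. Its labelled graph has nodes $(s,n)$ with $n\in C(s)$, and, when $c_s(n)=(r,\langle n_i\rangle_{i\in\mathrm{ar}(r)^{\mathrm{op}}})$, an edge from $n\in C(s)$ to $n_i\in C(\mathrm{prem}(r,i))$ labelled $i\in\mathrm{ar}(r)$ for each $i\in\mathrm{ar}(r)$. A solution of $c$ with respect to an algebra $a\colon F[P](\Omega)\to\Omega$ is a ca-morphism from $c$ to $a$, i.e. $h\colon C\to\Omega$ with $h=a\circ F[P](h)\circ c$. Trace structures.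 A trace structure for $P$ consists of: a presheaf $\mathrm{fml}\in\widehat{\mathrm{Jdg}}$; a proof system $T=(\int\mathrm{fml}\xleftarrow{\mathrm{prem}'}\int\mathrm{ar}'\xrightarrow{q_{\mathrm{ar}'}}R'\xrightarrow{\mathrm{ccl}'}\int\mathrm{fml})$ and a morphism $T\to P$ in $\mathbf{VPoly}$ whose component on judgements is the projection $p_{\mathrm{fml}}\colon\int\mathrm{fml}\to\mathrm{Jdg}$; and a set $\mathrm{prog}$ as follows. For $i\in\mathrm{ar}(r)$, $\varphi\in\mathrm{fml}(\mathrm{ccl}(r))$, $\psi\in\mathrm{fml}(\mathrm{prem}(r,i))$ write $\varphi\stackrel{i\in\mathrm{ar}(r)}{\rightsquigarrow}\psi$ if there is $i'\in\int\mathrm{ar}'$ with $(p_{\mathrm{fml}})_1(i')=(r,i)$, $\mathrm{prem}'(i')=\psi$ and $\mathrm{ccl}'(q_{\mathrm{ar}'}(i'))=\varphi$. Then $\mathrm{prog}$ is a subset of the set of all such steps $\varphi\stackrel{i\in\mathrm{ar}(r)}{\rightsquigarrow}\psi$ (ranging over all $(r,i)\in\int\mathrm{ar}$; elements are called progressing), and it is required that for each $h\colon r_1\to r_2$ in $R$ and $i\in\mathrm{ar}(r_1)$, $\varphi\stackrel{\mathrm{ar}(h)(i)\in\mathrm{ar}(r_2)}{\rightsquigarrow}\psi$ (resp. and it is in $\mathrm{prog}$) implies $\mathrm{fml}(\mathrm{ccl}(h))(\varphi)\stackrel{i\in\mathrm{ar}(r_1)}{\rightsquigarrow}\psi$ (resp.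 and it is in $\mathrm{prog}$). A trace along an infinite path $\langle n_k\in C(s_k)\rangle_{k\in\mathbb{N}}$ with labels $\langle j_k\in\mathrm{ar}(r_k)\rangle_{k\in\mathbb{N}}$ in the labelled graph of $c$ is a sequence $\varphi_k\in\mathrm{fml}(s_k)$ with $\varphi_k\stackrel{j_k\in\mathrm{ar}(r_k)}{\rightsquigarrow}\varphi_{k+1}$ for all $k$; it is infinitely progressing if infinitely many of these steps are in $\mathrm{prog}$. The pre-proof $c$ satisfies the global trace condition (GTC) on the trace structure, and is then called a proof, if for every infinite path in the labelled graph of $c$ there is an infinitely progressing trace along some suffix of it. Ordinal annotation. Identify $\gamma$ with $\{\alpha\mid\alpha<\gamma\}$. $\mathrm{Jdg}^\gamma$ has objects $(s,f)$ with $s\in\mathrm{Jdg}$ and $f\colon\mathrm{fml}(s)\to\gamma$ a function; a morphism $(s_1,f_1)\to(s_2,f_2)$ is $h\colon s_1\to s_2$ with $f_1(\mathrm{fml}(h)(\varphi))\le f_2(\varphi)$ for all $\varphi\in\mathrm{fml}(s_2)$. $R^\gamma$ has objects $(r,f)$ with $r\in R$, $f\colon\mathrm{fml}(\mathrm{ccl}(r))\to\gamma$; morphisms $(r_1,f_1)\to(r_2,f_2)$ are $h\colon r_1\to r_2$ such that $\mathrm{ccl}(h)\colon(\mathrm{ccl}(r_1),f_1)\to(\mathrm{ccl}(r_2),f_2)$ is in $\mathrm{Jdg}^\gamma$. $\mathrm{ar}^\gamma(r,f)$ has objects $(i,g)$ with $i\in\mathrm{ar}(r)$, $g\colon\mathrm{fml}(\mathrm{prem}(r,i))\to\gamma$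 such that for every $\varphi\stackrel{i\in\mathrm{ar}(r)}{\rightsquigarrow}\psi$ one has $g(\psi)\le f(\varphi)$, with $g(\psi)<f(\varphi)$ if this step is in $\mathrm{prog}$; morphisms $(i_1,g_1)\to(i_2,g_2)$ are $h\colon i_1\to i_2$ in $\mathrm{ar}(r)$ such that $\mathrm{prem}(r,h)$ is a morphism $(\mathrm{prem}(r,i_1),g_1)\to(\mathrm{prem}(r,i_2),g_2)$ in $\mathrm{Jdg}^\gamma$; and $\mathrm{ar}^\gamma(h)(i,g)=(\mathrm{ar}(h)(i),g)$, acting on morphisms as $\mathrm{ar}(h)$. Let $\mathrm{prem}^\gamma((i,g)\in\mathrm{ar}^\gamma(r,f))=(\mathrm{prem}(r,i),g)$ and $\mathrm{ccl}^\gamma(r,f)=(\mathrm{ccl}(r),f)$. Then $P^\gamma=(\mathrm{Jdg}^\gamma\xleftarrow{\mathrm{prem}^\gamma}\int\mathrm{ar}^\gamma\xrightarrow{q_{\mathrm{ar}^\gamma}}R^\gamma\xrightarrow{\mathrm{ccl}^\gamma}\mathrm{Jdg}^\gamma)$ is a proof system and the forgetful functors form a morphism $u^\gamma=(u^\gamma,u_1^\gamma,u_2^\gamma)\colon P^\gamma\to P$ in $\mathbf{VPoly}$.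
   Formalization: A proof system is required to have prem send each canonical arrow (h,id):(r1,i)→(r2,ar(h)(i)) to an identity, not only to satisfy prem(r1,i)=prem(r2,ar(h)(i)); without this P^γ need not be well defined. P^γ is not claimed to be two-sided, which the theorem does not need. -}

{-# OPTIONS --with-K #-}
module Defs where

open import Level using (Level; suc; _⊔_)
open import Axiom.Extensionality.Propositional using (Extensionality; implicit-extensionality)
open import Axiom.UniquenessOfIdentityProofs.WithK using (uip)
open import Data.Nat.Base as ℕ using (ℕ)
open import Data.Product.Base using (Σ; Σ-syntax; ∃; ∃-syntax; _×_; _,_; proj₁; proj₂)
open import Data.Product using (∃!)
open import Data.Sum.Base using (inj₂)
open import Data.Unit.Polymorphic.Base using (⊤; tt)
open import Induction.WellFounded using (WellFounded)
open import Relation.Binary.Core using (Rel)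
open import Relation.Binary.Structures using (IsStrictTotalOrder)
import Relation.Binary.Construct.StrictToNonStrict as NonStrict
open import Relation.Binary.PropositionalEquality.Core
  using (_≡_; refl; sym; trans; cong; cong₂; subst)
open import Relation.Binary.PropositionalEquality.Properties using (isEquivalence; module ≡-Reasoning)

open ≡-Reasoning

-- The equations between objects that discrete fibrations
-- and strict pullbacks require are propositional equations; with axiom K
-- every type is a set, so `Set ℓ` is read as the category of small sets.

record Category (o h : Level) : Set (suc (o ⊔ h)) where
  no-eta-equality
  constructor mkCategory
  infixr 9 _∘_
  field
    Obj   : Set o
    Hom   : Obj → Obj → Set h
    id    : ∀ {x} → Hom x x
    _∘_   : ∀ {x y z} → Hom y z → Hom x y → Hom x z
    idˡ   : ∀ {x y} (f : Hom x y) → id ∘ f ≡ f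
    idʳ   : ∀ {x y} (f : Hom x y) → f ∘ id ≡ f
    assoc : ∀ {w x y z} (f : Hom y z) (g : Hom x y) (k : Hom w x) → (f ∘ g) ∘ k ≡ f ∘ (g ∘ k)

  ∘-congˡ : ∀ {x y z} {f : Hom y z} {g g′ : Hom x y} → g ≡ g′ → f ∘ g ≡ f ∘ g′
  ∘-congˡ refl = refl

  ∘-congʳ : ∀ {x y z} {f f′ : Hom y z} {g : Hom x y} → f ≡ f′ → f ∘ g ≡ f′ ∘ g
  ∘-congʳ refl = refl

  -- The identity, seen as an arrow between propositionally equal objects.
  opaque
    eqHom : ∀ {x y} → x ≡ y → Hom x y
    eqHom refl = id

    eqHom-id : ∀ {x} (p : x ≡ x) → eqHom p ≡ id
    eqHom-id refl = refl

    eqHom-∘ : ∀ {x y z} (p : x ≡ y) (q : y ≡ z) → eqHom q ∘ eqHom p ≡ eqHom (trans p q)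
    eqHom-∘ refl q = idʳ _

  eqHom-irr : ∀ {x y} (p q : x ≡ y) → eqHom p ≡ eqHom q
  eqHom-irr p q = cong eqHom (uip p q)

  eqHom-comp : ∀ {x y z} (q : y ≡ z) (p : x ≡ y) (r : x ≡ z) → eqHom q ∘ eqHom p ≡ eqHom r
  eqHom-comp q p r = trans (eqHom-∘ p q) (eqHom-irr (trans p q) r)

  Into : Obj → Set (o ⊔ h)
  Into x = Σ[ w ∈ Obj ] Hom w x

  OutOf : Obj → Set (o ⊔ h)
  OutOf x = Σ[ y ∈ Obj ] Hom x y

  Arr : Set (o ⊔ h)
  Arr = Σ[ x ∈ Obj ] Σ[ y ∈ Obj ] Hom x y

  arr : ∀ {x y} → Hom x y → Arr
  arr {x} {y} f = x , y , f

  arr-injective : ∀ {x y} {f g : Hom x y} → arr f ≡ arr g → f ≡ g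
  arr-injective refl = refl

{-# INLINE mkCategory #-}

open Category using (Obj; Hom; Into; OutOf; Arr; arr; eqHom)

record Functor {o h o′ h′} (C : Category o h) (D : Category o′ h′) : Set (o ⊔ h ⊔ o′ ⊔ h′) where
  no-eta-equality; pattern
  constructor mkFunctor
  private
    module C = Category C
    module D = Category D
  field
    F₀  : C.Obj → D.Obj
    F₁  : ∀ {x y} → C.Hom x y → D.Hom (F₀ x) (F₀ y)
    F-id : ∀ {x} → F₁ (C.id {x}) ≡ D.id
    F-∘ : ∀ {x y z} (g : C.Hom y z) (f : C.Hom x y) → F₁ (g C.∘ f) ≡ F₁ g D.∘ F₁ f

  F-eqHom : ∀ {x y} (p : x ≡ y) (q : F₀ x ≡ F₀ y) → F₁ (C.eqHom p) ≡ D.eqHom q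
  F-eqHom {x} refl q = trans (cong F₁ (C.eqHom-id refl)) (trans F-id (sym (D.eqHom-id q)))

  mapInto : ∀ {x} → C.Into x → D.Into (F₀ x)
  mapInto (w , f) = F₀ w , F₁ f

  mapOutOf : ∀ {x} → C.OutOf x → D.OutOf (F₀ x)
  mapOutOf (y , f) = F₀ y , F₁ f

  mapArr : C.Arr → D.Arr
  mapArr (x , y , f) = F₀ x , F₀ y , F₁ f

open Functor using (F₀; F₁; F-id; F-∘; mapInto; mapOutOf; mapArr)

idF : ∀ {o h} {C : Category o h} → Functor C C
idF = record { F₀ = λ x → x ; F₁ = λ f → f ; F-id = refl ; F-∘ = λ _ _ → refl }

infixr 9 _∘F_
_∘F_ : ∀ {o h o′ h′ o″ h″} {C : Category o h} {D : Category o′ h′} {E : Category o″ h″} →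
       Functor D E → Functor C D → Functor C E
G ∘F F = record
  { F₀   = λ x → F₀ G (F₀ F x)
  ; F₁   = λ f → F₁ G (F₁ F f)
  ; F-id = trans (cong (F₁ G) (F-id F)) (F-id G)
  ; F-∘  = λ g f → trans (cong (F₁ G) (F-∘ F g f)) (F-∘ G _ _) }

module _ {o h o′ h′} {C : Category o h} {D : Category o′ h′} {F G : Functor C D} (e : F ≡ G) where
  private
    module C = Category C
    module D = Category D

  eq₀ : ∀ x → F₀ F x ≡ F₀ G x
  eq₀ x = cong (λ H → F₀ H x) e

  eqF : ∀ x → D.Hom (F₀ F x) (F₀ G x)
  eqF x = D.eqHom (eq₀ x)

eqF-natural : ∀ {o h o′ h′} {C : Category o h} {D : Category o′ h′} {F G : Functor C D} (e : F ≡ G) →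
              let open Category D using (_∘_) in
              ∀ {x y} (f : Hom C x y) → eqF e y ∘ F₁ F f ≡ F₁ G f ∘ eqF e x
eqF-natural {D = D} refl f =
  trans (trans (D.∘-congʳ (D.eqHom-id refl)) (D.idˡ _)) (sym (trans (D.∘-congˡ (D.eqHom-id refl)) (D.idʳ _)))
  where module D = Category D

module _ {ℓ} {E B : Category ℓ ℓ} where

  -- The lift is a pair of an object e′ and an arrow e′ → e.
  DiscreteFibration : Functor E B → Set ℓ
  DiscreteFibration t =
    ∀ e {b} (f : Hom B b (F₀ t e)) → ∃! _≡_ λ (l : Into E e) → mapInto t l ≡ (b , f)

module _ {ℓ} {I A B : Category ℓ ℓ} where
  private
    module I = Category I
    module A = Category A
    module B = Category B

  record TwoSidedDiscreteFibration (s : Functor I A) (q : Functor I B) : Set ℓ where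
    field
      liftˡ : ∀ i {a} (f : A.Hom a (F₀ s i)) →
              ∃! _≡_ λ (l : I.Into i) → mapInto s l ≡ (a , f) × mapInto q l ≡ (F₀ q i , B.id)
      liftʳ : ∀ i {b} (g : B.Hom (F₀ q i) b) →
              ∃! _≡_ λ (l : I.OutOf i) → mapOutOf q l ≡ (b , g) × mapOutOf s l ≡ (F₀ s i , A.id)
      factor : ∀ {i j} (f : I.Hom i j) →
               let (c , r) = proj₁ (liftʳ i (F₁ q f))
                   (d , l) = proj₁ (liftˡ j (F₁ s f))
               in Σ[ e ∈ c ≡ d ] l I.∘ (I.eqHom e I.∘ r) ≡ f

IsPullbackSet : ∀ {ℓ} {A′ A J′ J : Set ℓ} → (J′ → A′) → (J′ → J) → (A′ → A) → (J → A) → Set ℓ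
IsPullbackSet t′ v u t =
  ∀ a′ j → u a′ ≡ t j → ∃! _≡_ λ j′ → t′ j′ ≡ a′ × v j′ ≡ j

-- A commutative square of small categories is a pullback when it is one
-- on sets of objects and on sets of arrows, that is, when J′ is carried
-- isomorphically onto the strict fibre product of A′ and J over A.
record IsPullback {ℓ} {A′ A J′ J : Category ℓ ℓ}
                  (t′ : Functor J′ A′) (v : Functor J′ J) (u : Functor A′ A) (t : Functor J A) : Set ℓ where
  field
    commutes : u ∘F t′ ≡ t ∘F v
    objects  : IsPullbackSet (F₀ t′) (F₀ v) (F₀ u) (F₀ t)
    arrows   : IsPullbackSet (mapArr t′) (mapArr v) (mapArr u) (mapArr t)

-- An ordinal γ = {α | α < γ} is given, up to isomorphism, as a well-ordered set.
record Ordinal (ℓ : Level) : Set (suc ℓ) where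
  infix 4 _<_
  field
    Carrier            : Set ℓ
    _<_                : Rel Carrier ℓ
    isStrictTotalOrder : IsStrictTotalOrder _≡_ _<_
    wellFounded        : WellFounded _<_

  open IsStrictTotalOrder isStrictTotalOrder public using (<-resp-≈) renaming (trans to <-trans)
  open NonStrict _≡_ _<_ public using (_≤_)

  ≤-reflexive : ∀ {x y} → x ≡ y → x ≤ y
  ≤-reflexive = inj₂

  ≤-trans : ∀ {x y z} → x ≤ y → y ≤ z → x ≤ z
  ≤-trans = NonStrict.trans _≡_ _<_ isEquivalence <-resp-≈ <-trans

  <-≤-trans : ∀ {x y z} → x < y → y ≤ z → x < z
  <-≤-trans = NonStrict.<-≤-trans _≡_ _<_ <-trans (proj₁ <-resp-≈)

record FunExt (ℓ : Level) : Set (suc ℓ) where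
  field
    ext : Extensionality ℓ ℓ

-- Everything below lives at one universe level ("small") and uses
-- function extensionality, which is needed already for the functor laws
-- of the right Kan extension.

module Theory {ℓ : Level} ⦃ funExt : FunExt ℓ ⦄ where

  open FunExt funExt

  SmallCategory : Set (suc ℓ)
  SmallCategory = Category ℓ ℓ

  private
    iext : ∀ {A : Set ℓ} {B : A → Set ℓ} {f g : {x : A} → B x} →
           (∀ {x} → f {x} ≡ g {x}) → (λ {x} → f {x}) ≡ (λ {x} → g {x})
    iext = implicit-extensionality ext

  functor-≡ : {C D : SmallCategory} {F G : Functor C D} →
              (∀ x → F₀ F x ≡ F₀ G x) →
              (∀ {x y} (f : Hom C x y) → arr D (F₁ F f) ≡ arr D (F₁ G f)) → F ≡ G
  functor-≡ {C} {D} {mkFunctor _ F₁ Fi Fc} {mkFunctor _ G₁ Gi Gc} p q = go F₁ G₁ (ext p) q Fi Gi Fc Gc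
    where
    module C = Category C
    module D = Category D
    go : ∀ {F₀ G₀ : C.Obj → D.Obj}
         (F₁ : ∀ {x y} → C.Hom x y → D.Hom (F₀ x) (F₀ y)) (G₁ : ∀ {x y} → C.Hom x y → D.Hom (G₀ x) (G₀ y)) →
         F₀ ≡ G₀ → (∀ {x y} (f : C.Hom x y) → D.arr (F₁ f) ≡ D.arr (G₁ f)) →
         (Fi : ∀ {x} → F₁ (C.id {x}) ≡ D.id) (Gi : ∀ {x} → G₁ (C.id {x}) ≡ D.id)
         (Fc : ∀ {x y z} (g : C.Hom y z) (f : C.Hom x y) → F₁ (g C.∘ f) ≡ F₁ g D.∘ F₁ f)
         (Gc : ∀ {x y z} (g : C.Hom y z) (f : C.Hom x y) → G₁ (g C.∘ f) ≡ G₁ g D.∘ G₁ f) →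
         _≡_ {A = Functor C D}
             (record { F₀ = F₀ ; F₁ = F₁ ; F-id = Fi ; F-∘ = Fc })
             (record { F₀ = G₀ ; F₁ = G₁ ; F-id = Gi ; F-∘ = Gc })
    go {F₀} F₁ G₁ refl h Fi Gi Fc Gc = go′ F₁ G₁ e Fi Gi Fc Gc
      where
      e : (λ {x} {y} → F₁ {x} {y}) ≡ (λ {x} {y} → G₁ {x} {y})
      e = iext (iext (ext (λ f → D.arr-injective (h f))))
      go′ : (F₁ G₁ : ∀ {x y} → C.Hom x y → D.Hom (F₀ x) (F₀ y)) →
            (λ {x} {y} → F₁ {x} {y}) ≡ (λ {x} {y} → G₁ {x} {y}) →
            (Fi : ∀ {x} → F₁ (C.id {x}) ≡ D.id) (Gi : ∀ {x} → G₁ (C.id {x}) ≡ D.id)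
            (Fc : ∀ {x y z} (g : C.Hom y z) (f : C.Hom x y) → F₁ (g C.∘ f) ≡ F₁ g D.∘ F₁ f)
            (Gc : ∀ {x y z} (g : C.Hom y z) (f : C.Hom x y) → G₁ (g C.∘ f) ≡ G₁ g D.∘ G₁ f) →
            _≡_ {A = Functor C D}
                (record { F₀ = F₀ ; F₁ = F₁ ; F-id = Fi ; F-∘ = Fc })
                (record { F₀ = F₀ ; F₁ = G₁ ; F-id = Gi ; F-∘ = Gc })
      go′ F₁ .F₁ refl Fi Gi Fc Gc = cong₂ mk (iext (uip _ _)) (iext (iext (iext (ext λ g → ext λ f → uip _ _))))
        where
        mk : (∀ {x} → F₁ (C.id {x}) ≡ D.id) →
             (∀ {x y z} (g : C.Hom y z) (f : C.Hom x y) → F₁ (g C.∘ f) ≡ F₁ g D.∘ F₁ f) → Functor C D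
        mk i c = record { F₀ = F₀ ; F₁ = F₁ ; F-id = i ; F-∘ = c }

  Cats : Category (suc ℓ) ℓ
  Cats = record
    { Obj = SmallCategory ; Hom = Functor ; id = idF ; _∘_ = _∘F_
    ; idˡ   = λ _ → functor-≡ (λ _ → refl) (λ _ → refl)
    ; idʳ   = λ _ → functor-≡ (λ _ → refl) (λ _ → refl)
    ; assoc = λ _ _ _ → functor-≡ (λ _ → refl) (λ _ → refl) }

  -- Functors A^op → Set.
  record Presheaf (A : SmallCategory) : Set (suc ℓ) where
    no-eta-equality
    constructor mkPresheaf
    private module A = Category A
    field
      El     : A.Obj → Set ℓ
      res    : ∀ {a b} → A.Hom a b → El b → El a
      res-id : ∀ {a} (x : El a) → res A.id x ≡ x
      res-∘  : ∀ {a b c} (g : A.Hom b c) (f : A.Hom a b) x → res (g A.∘ f) x ≡ res f (res g x)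

  {-# INLINE mkPresheaf #-}

  open Presheaf public

  infix 4 _⇒_ _≈_
  infixr 9 _∙_
  record _⇒_ {A : SmallCategory} (X Y : Presheaf A) : Set ℓ where
    no-eta-equality
    constructor mkNat
    field
      at      : ∀ a → El X a → El Y a
      natural : ∀ {a b} (f : Hom A a b) x → at a (res X f x) ≡ res Y f (at b x)

  {-# INLINE mkNat #-}

  open _⇒_ public

  _≈_ : ∀ {A} {X Y : Presheaf A} → X ⇒ Y → X ⇒ Y → Set ℓ
  α ≈ β = ∀ a x → at α a x ≡ at β a x

  _∙_ : ∀ {A} {X Y Z : Presheaf A} → Y ⇒ Z → X ⇒ Y → X ⇒ Z
  β ∙ α = record
    { at      = λ a x → at β a (at α a x)
    ; natural = λ f x → trans (cong (at β _) (natural α f x)) (natural β f _) }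

  ∫ : {A : SmallCategory} → Presheaf A → SmallCategory
  ∫ {A} X = record
    { Obj = Σ[ a ∈ Obj A ] El X a
    ; Hom = λ (a , x) (b , y) → Σ[ f ∈ A.Hom a b ] res X f y ≡ x
    ; id  = A.id , res-id X _
    ; _∘_ = λ (g , q) (f , p) → g A.∘ f , trans (res-∘ X g f _) (trans (cong (res X f) q) p)
    ; idˡ = λ (f , _) → el-≡ (A.idˡ f)
    ; idʳ = λ (f , _) → el-≡ (A.idʳ f)
    ; assoc = λ (f , _) (g , _) (k , _) → el-≡ (A.assoc f g k) }
    where
    module A = Category A
    el-≡ : ∀ {a b} {x : El X a} {y : El X b} {f g : Σ[ f ∈ A.Hom a b ] res X f y ≡ x} →
           proj₁ f ≡ proj₁ g → f ≡ g
    el-≡ {f = f , p} {.f , p′} refl = cong (f ,_) (uip p p′)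

  π : {A : SmallCategory} (X : Presheaf A) → Functor (∫ X) A
  π X = record { F₀ = proj₁ ; F₁ = proj₁ ; F-id = refl ; F-∘ = λ _ _ → refl }

  module _ {I J : SmallCategory} (f : Functor I J) where
    private
      module I = Category I
      module J = Category J

    _^* : Presheaf J → Presheaf I
    _^* X = record
      { El     = λ i → El X (F₀ f i)
      ; res    = λ g → res X (F₁ f g)
      ; res-id = λ x → trans (cong (λ g → res X g x) (F-id f)) (res-id X x)
      ; res-∘  = λ g h x → trans (cong (λ k → res X k x) (F-∘ f g h)) (res-∘ X _ _ x) }

    _^*₁ : {X Y : Presheaf J} → X ⇒ Y → _^* X ⇒ _^* Y
    _^*₁ α = record { at = λ i → at α (F₀ f i) ; natural = λ g → natural α (F₁ f g) }

    -- (f_* X)(j) = Nat (f^* y_j , X), the pointwise right Kan extension.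
    record Ran (X : Presheaf I) (j : J.Obj) : Set ℓ where
      no-eta-equality; pattern
      constructor mkRan
      field
        fam        : ∀ i → J.Hom (F₀ f i) j → El X i
        compatible : ∀ {i i′} (g : I.Hom i i′) (k : J.Hom (F₀ f i′) j) →
                     res X g (fam i′ k) ≡ fam i (k J.∘ F₁ f g)

    open Ran public

    Ran-≡ : ∀ X {j} {m n : Ran X j} → (∀ i k → fam m i k ≡ fam n i k) → m ≡ n
    Ran-≡ X {j} {mkRan _ c} {mkRan _ c′} e = go (ext λ i → ext (e i)) c c′
      where
      go : ∀ {fam fam′ : ∀ i → J.Hom (F₀ f i) j → El X i} → fam ≡ fam′ →
           (c  : ∀ {i i′} (g : I.Hom i i′) (k : J.Hom (F₀ f i′) j) →
                 res X g (fam i′ k) ≡ fam i (k J.∘ F₁ f g))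
           (c′ : ∀ {i i′} (g : I.Hom i i′) (k : J.Hom (F₀ f i′) j) →
                 res X g (fam′ i′ k) ≡ fam′ i (k J.∘ F₁ f g)) →
           _≡_ {A = Ran X j} (record { fam = fam ; compatible = c }) (record { fam = fam′ ; compatible = c′ })
      go {fam} refl c c′ = cong mk (iext (iext (ext λ g → ext λ k → uip _ _)))
        where
        mk : (∀ {i i′} (g : I.Hom i i′) (k : J.Hom (F₀ f i′) j) →
              res X g (fam i′ k) ≡ fam i (k J.∘ F₁ f g)) → Ran X j
        mk c = record { fam = fam ; compatible = c }

    ran-map : ∀ X {j j′} → J.Hom j′ j → Ran X j → Ran X j′
    ran-map X h n = record
      { fam        = λ i k → fam n i (h J.∘ k)
      ; compatible = λ g k → trans (compatible n g _) (cong (fam n _) (J.assoc h k (F₁ f g))) }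

    _₊ : Presheaf I → Presheaf J
    _₊ X = record
      { El     = Ran X
      ; res    = ran-map X
      ; res-id = λ n → Ran-≡ X λ i k → cong (fam n i) (J.idˡ k)
      ; res-∘  = λ g h n → Ran-≡ X λ i k → cong (fam n i) (J.assoc g h k) }

    _₊₁ : {X Y : Presheaf I} → X ⇒ Y → _₊ X ⇒ _₊ Y
    _₊₁ {X} {Y} α = record
      { at = λ j n → record
          { fam        = λ i k → at α i (fam n i k)
          ; compatible = λ g k → trans (sym (natural α g _)) (cong (at α _) (compatible n g k)) }
      ; natural = λ h n → Ran-≡ Y λ i k → refl }

    unit : (X : Presheaf J) → X ⇒ _₊ (_^* X)
    unit X = record
      { at = λ j x → record
          { fam        = λ i k → res X k x
          ; compatible = λ g k → sym (res-∘ X k (F₁ f g) x) }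
      ; natural = λ h x → Ran-≡ (_^* X) λ i k → sym (res-∘ X h k x) }

    counit : (X : Presheaf I) → _^* (_₊ X) ⇒ X
    counit X = record
      { at      = λ i n → fam n i J.id
      ; natural = λ g n → trans (cong (fam n _) (trans (J.idʳ _) (sym (J.idˡ _)))) (sym (compatible n g J.id)) }

    triangleˡ : ∀ (X : Presheaf J) i x → at (counit (_^* X)) i (at (_^*₁ (unit X)) i x) ≡ x
    triangleˡ X i x = res-id X x

    triangleʳ : ∀ (X : Presheaf I) j n → at (_₊₁ (counit X)) j (at (unit (_₊ X)) j n) ≡ n
    triangleʳ X j n = Ran-≡ X λ i k → cong (fam n i) (J.idʳ k)

  -- t_! for a discrete fibration t: (t_! X)(b) is the coproduct of the X(e)
  -- over the fibre of t at b.
  module _ {E B : SmallCategory} (t : Functor E B) (fib : DiscreteFibration t) where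
    private
      module E = Category E
      module B = Category B

    Lan : Presheaf E → B.Obj → Set ℓ
    Lan X b = Σ[ e ∈ E.Obj ] F₀ t e ≡ b × El X e

    into-≡ : ∀ {c b b′} {f : B.Hom b c} {f′ : B.Hom b′ c} (p : b ≡ b′) →
             f B.∘ B.eqHom (sym p) ≡ f′ → _≡_ {A = B.Into c} (b , f) (b′ , f′)
    into-≡ refl q = cong (_ ,_) (trans (sym (trans (B.∘-congˡ (B.eqHom-id refl)) (B.idʳ _))) q)

    into-≡⁻ : ∀ {c} {v w : B.Into c} (e : v ≡ w) → proj₂ v B.∘ B.eqHom (sym (cong proj₁ e)) ≡ proj₂ w
    into-≡⁻ refl = trans (B.∘-congˡ (B.eqHom-id refl)) (B.idʳ _)

    -- The unique lift of the composite b → b′ = t e.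
    module Lift {b b′} (f : B.Hom b b′) {e} (p : F₀ t e ≡ b′) where
      private
        lifting = fib e (B.eqHom (sym p) B.∘ f)

      source : E.Obj
      source = proj₁ (proj₁ lifting)

      lift : E.Hom source e
      lift = proj₂ (proj₁ lifting)

      over : F₀ t source ≡ b
      over = cong proj₁ (proj₁ (proj₂ lifting))

      commute : F₁ t lift B.∘ B.eqHom (sym over) ≡ B.eqHom (sym p) B.∘ f
      commute = into-≡⁻ (proj₁ (proj₂ lifting))

      unique : ∀ {e′} (p′ : F₀ t e′ ≡ b) (l : E.Hom e′ e) →
               F₁ t l B.∘ B.eqHom (sym p′) ≡ B.eqHom (sym p) B.∘ f →
               _≡_ {A = E.Into e} (source , lift) (e′ , l)
      unique p′ l q = proj₂ (proj₂ lifting) (into-≡ p′ q)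

    lan-map : ∀ X {b b′} → B.Hom b b′ → Lan X b′ → Lan X b
    lan-map X f (e , p , x) = source , over , res X lift x
      where open Lift f p

    lan-map-unique : ∀ X {b b′} (f : B.Hom b b′) {e e′} (p : F₀ t e ≡ b′) (x : El X e)
                     (p′ : F₀ t e′ ≡ b) (l : E.Hom e′ e) →
                     F₁ t l B.∘ B.eqHom (sym p′) ≡ B.eqHom (sym p) B.∘ f →
                     lan-map X f (e , p , x) ≡ (e′ , p′ , res X l x)
    lan-map-unique X {b} f {e} {e′} p x p′ l q = go (Lift.over f p) (Lift.unique f p p′ l q)
      where
      go : ∀ {k : E.Into e} (r : F₀ t (proj₁ k) ≡ b) → k ≡ (e′ , l) →
           _≡_ {A = Lan X b} (proj₁ k , r , res X (proj₂ k) x) (e′ , p′ , res X l x)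
      go r refl = cong (λ r → e′ , r , res X l x) (uip r p′)

    lan : Presheaf E → Presheaf B
    lan X = record
      { El     = Lan X
      ; res    = lan-map X
      ; res-id = λ (e , p , x) →
          trans (lan-map-unique X B.id p x p E.id
                  (trans (B.∘-congʳ (F-id t)) (trans (B.idˡ _) (sym (B.idʳ _)))))
                (cong (λ y → e , p , y) (res-id X x))
      ; res-∘  = comp }
      where
      comp : ∀ {a b c} (g : B.Hom b c) (f : B.Hom a b) (z : Lan X c) →
             lan-map X (g B.∘ f) z ≡ lan-map X f (lan-map X g z)
      comp g f (e , p , x) =
        trans (lan-map-unique X (g B.∘ f) p x L₂.over (L₁.lift E.∘ L₂.lift) (begin
                 F₁ t (L₁.lift E.∘ L₂.lift) B.∘ B.eqHom (sym L₂.over)        ≡⟨ B.∘-congʳ (F-∘ t L₁.lift L₂.lift) ⟩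
                 (F₁ t L₁.lift B.∘ F₁ t L₂.lift) B.∘ B.eqHom (sym L₂.over)   ≡⟨ B.assoc _ _ _ ⟩
                 F₁ t L₁.lift B.∘ (F₁ t L₂.lift B.∘ B.eqHom (sym L₂.over))   ≡⟨ B.∘-congˡ L₂.commute ⟩
                 F₁ t L₁.lift B.∘ (B.eqHom (sym L₁.over) B.∘ f)              ≡⟨ sym (B.assoc _ _ _) ⟩
                 (F₁ t L₁.lift B.∘ B.eqHom (sym L₁.over)) B.∘ f              ≡⟨ B.∘-congʳ L₁.commute ⟩
                 (B.eqHom (sym p) B.∘ g) B.∘ f                               ≡⟨ B.assoc _ _ _ ⟩
                 B.eqHom (sym p) B.∘ (g B.∘ f)                               ∎))
              (cong (λ y → L₂.source , L₂.over , y) (res-∘ X L₁.lift L₂.lift x))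
        where
        module L₁ = Lift g p
        module L₂ = Lift f L₁.over

    lan₁ : {X Y : Presheaf E} → X ⇒ Y → lan X ⇒ lan Y
    lan₁ {X} {Y} α = record
      { at      = λ b (e , p , x) → e , p , at α e x
      ; natural = λ f (e , p , x) → cong (λ y → Lift.source f p , Lift.over f p , y) (natural α (Lift.lift f p) x) }

  -- The data of A ←s– I –q→ J –t→ A with t a discrete fibration, which is all
  -- that the functor t_! q_* s^* depends on.
  record Diagram (A : SmallCategory) : Set (suc ℓ) where
    no-eta-equality
    constructor mkDiagram
    field
      I J         : SmallCategory
      s           : Functor I A
      q           : Functor I J
      t           : Functor J A
      t-fibration : DiscreteFibration t

  {-# INLINE mkDiagram #-}

  IsPolynomial : ∀ {A} → Diagram A → Set ℓ
  IsPolynomial D = TwoSidedDiscreteFibration (Diagram.s D) (Diagram.q D)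

  -- An element of F[ D ] X at a is (j , p : t j ≡ a , n) with n a compatible
  -- family indexed by pairs (i , q i → j).  Evaluating n at (i , id) gives
  -- the component n_i of the corresponding family over the fibre of q.
  F[_] : ∀ {A} → Diagram A → Presheaf A → Presheaf A
  F[ D ] X = lan t t-fibration ((q ₊) ((s ^*) X))
    where open Diagram D

  F[_]₁ : ∀ {A} (D : Diagram A) {X Y : Presheaf A} → X ⇒ Y → F[ D ] X ⇒ F[ D ] Y
  F[ D ]₁ α = lan₁ t t-fibration ((q ₊₁) ((s ^*₁) α))
    where open Diagram D

  Coalgebra Algebra : ∀ {A} → Diagram A → Presheaf A → Set ℓ
  Coalgebra D C = C ⇒ F[ D ] C
  Algebra D Ω = F[ D ] Ω ⇒ Ω

  record IsSolution {A : SmallCategory} (D : Diagram A) (C Ω : Presheaf A) (c : Coalgebra D C) (a : Algebra D Ω)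
                    (h : C ⇒ Ω) : Set ℓ where
    field
      equation : h ≈ a ∙ (F[ D ]₁ h ∙ c)

  HasUniqueSolution : ∀ {A} (D : Diagram A) (C Ω : Presheaf A) → Coalgebra D C → Algebra D Ω → Set ℓ
  HasUniqueSolution D C Ω c a = ∃! (_≈_ {X = C} {Ω}) (IsSolution D C Ω c a)

  -- Morphisms of VPoly whose component A′ → A is u.
  record VMorphism {A′ A : SmallCategory} (u : Functor A′ A) (D′ : Diagram A′) (D : Diagram A) : Set (suc ℓ) where
    no-eta-equality
    constructor mkVMorphism
    private
      module D′ = Diagram D′
      module D  = Diagram D
    field
      u₁       : Functor D′.I D.I
      u₂       : Functor D′.J D.J
      s-square : u ∘F D′.s ≡ D.s ∘F u₁
      q-square : u₂ ∘F D′.q ≡ D.q ∘F u₁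
      pullback : IsPullback D′.t u₂ u D.t

  {-# INLINE mkVMorphism #-}

  module Mate {A′ A : SmallCategory} {u : Functor A′ A} {D′ : Diagram A′} {D : Diagram A}
              (M : VMorphism u D′ D) where
    private
      module A  = Category A
      module A′ = Category A′
      module D′ = Diagram D′
      module D  = Diagram D
      module I  = Category D.I
      module I′ = Category D′.I
      module J  = Category D.J
      module J′ = Category D′.J
    open VMorphism M
    open IsPullback pullback

    along : ∀ {i′ j′ j} → F₀ u₂ j′ ≡ j → J′.Hom (F₀ D′.q i′) j′ → J.Hom (F₀ D.q (F₀ u₁ i′)) j
    along {i′} e k = (J.eqHom e J.∘ F₁ u₂ k) J.∘ eqF (sym q-square) i′

    along-∘ : ∀ {i i′ j′ j} (e : F₀ u₂ j′ ≡ j) (k : J′.Hom (F₀ D′.q i′) j′) (g : I′.Hom i i′) →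
              along e k J.∘ F₁ D.q (F₁ u₁ g) ≡ along e (k J′.∘ F₁ D′.q g)
    along-∘ e k g = begin
      ((J.eqHom e J.∘ F₁ u₂ k) J.∘ eqF (sym q-square) _) J.∘ F₁ D.q (F₁ u₁ g)
        ≡⟨ J.assoc _ _ _ ⟩
      (J.eqHom e J.∘ F₁ u₂ k) J.∘ (eqF (sym q-square) _ J.∘ F₁ D.q (F₁ u₁ g))
        ≡⟨ J.∘-congˡ (eqF-natural (sym q-square) g) ⟩
      (J.eqHom e J.∘ F₁ u₂ k) J.∘ (F₁ u₂ (F₁ D′.q g) J.∘ eqF (sym q-square) _)
        ≡⟨ sym (J.assoc _ _ _) ⟩
      ((J.eqHom e J.∘ F₁ u₂ k) J.∘ F₁ u₂ (F₁ D′.q g)) J.∘ eqF (sym q-square) _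
        ≡⟨ J.∘-congʳ (trans (J.assoc _ _ _) (J.∘-congˡ (sym (F-∘ u₂ k _)))) ⟩
      (J.eqHom e J.∘ F₁ u₂ (k J′.∘ F₁ D′.q g)) J.∘ eqF (sym q-square) _ ∎

    -- The family ⟨ n (u₁ i′) ⟩; the arrows eqF are identities up to the
    -- equations u s′ = s u₁ and u₂ q′ = q u₁.
    reindex : ∀ (X : Presheaf A) {j′ j} → F₀ u₂ j′ ≡ j →
              Ran D.q ((D.s ^*) X) j → Ran D′.q ((D′.s ^*) ((u ^*) X)) j′
    reindex X e n = record
      { fam        = λ i′ k → res X (eqF s-square i′) (fam n (F₀ u₁ i′) (along e k))
      ; compatible = λ {i} {i′} g k → begin
          res X (F₁ u (F₁ D′.s g)) (res X (eqF s-square i′) (fam n (F₀ u₁ i′) (along e k)))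
            ≡⟨ sym (res-∘ X _ _ _) ⟩
          res X (eqF s-square i′ A.∘ F₁ u (F₁ D′.s g)) (fam n (F₀ u₁ i′) (along e k))
            ≡⟨ cong (λ f → res X f (fam n (F₀ u₁ i′) (along e k))) (eqF-natural s-square g) ⟩
          res X (F₁ D.s (F₁ u₁ g) A.∘ eqF s-square i) (fam n (F₀ u₁ i′) (along e k))
            ≡⟨ res-∘ X _ _ _ ⟩
          res X (eqF s-square i) (res X (F₁ D.s (F₁ u₁ g)) (fam n (F₀ u₁ i′) (along e k)))
            ≡⟨ cong (res X (eqF s-square i)) (compatible n (F₁ u₁ g) (along e k)) ⟩
          res X (eqF s-square i) (fam n (F₀ u₁ i) (along e k J.∘ F₁ D.q (F₁ u₁ g)))
            ≡⟨ cong (λ f → res X (eqF s-square i) (fam n (F₀ u₁ i) f)) (along-∘ e k g) ⟩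
          res X (eqF s-square i) (fam n (F₀ u₁ i) (along e (k J′.∘ F₁ D′.q g))) ∎ }

    τ-at : ∀ (X : Presheaf A) a′ → El (F[ D ] X) (F₀ u a′) → El (F[ D′ ] ((u ^*) X)) a′
    τ-at X a′ (j , p , n) =
      let (j′ , (p′ , e) , _) = objects a′ j (sym p) in j′ , p′ , reindex X e n

    τ-at-unique : ∀ (X : Presheaf A) {a′ j} (p : F₀ D.t j ≡ F₀ u a′) n {j′} (p′ : F₀ D′.t j′ ≡ a′) (e : F₀ u₂ j′ ≡ j) →
                  τ-at X a′ (j , p , n) ≡ (j′ , p′ , reindex X e n)
    τ-at-unique X {a′} {j} p n {j′} p′ e =
      let (_ , (r₀ , e₀) , unique) = objects a′ j (sym p) in go {r = r₀} {e₀} (unique {j′} (p′ , e))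
      where
      go : ∀ {k} {r : F₀ D′.t k ≡ a′} {d : F₀ u₂ k ≡ j} → k ≡ j′ →
           _≡_ {A = El (F[ D′ ] ((u ^*) X)) a′} (k , r , reindex X d n) (j′ , p′ , reindex X e n)
      go {r = r} {d} refl = cong₂ (λ r d → j′ , r , reindex X d n) (uip r p′) (uip d e)

    τ : (X : Presheaf A) → (u ^*) (F[ D ] X) ⇒ F[ D′ ] ((u ^*) X)
    τ X = record { at = τ-at X ; natural = nat }
      where
      Y = (D.q ₊) ((D.s ^*) X)
      X′ = (D′.s ^*) ((u ^*) X)
      nat : ∀ {b a} (f : A′.Hom b a) z →
            τ-at X b (lan-map D.t D.t-fibration Y (F₁ u f) z) ≡
            lan-map D′.t D′.t-fibration ((D′.q ₊) X′) f (τ-at X a z)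
      nat {b} {a} f (j , p , n) =
        trans (cong (τ-at X b) (lan-map-unique D.t D.t-fibration Y (F₁ u f) {j} {F₀ u₂ j₁} p n p₂ m square))
        (trans (τ-at-unique X {b} {F₀ u₂ j₁} p₂ (ran-map D.q ((D.s ^*) X) m n) {j₁} p₁ refl)
               (cong (λ x → j₁ , p₁ , x) fams))
        where
        found = objects a j (sym p)
        j′ : J′.Obj
        j′ = proj₁ found
        p′ : F₀ D′.t j′ ≡ a
        p′ = proj₁ (proj₁ (proj₂ found))
        e : F₀ u₂ j′ ≡ j
        e = proj₂ (proj₁ (proj₂ found))
        open Lift D′.t D′.t-fibration f p′ renaming (source to j₁; lift to l; over to p₁; commute to q₁)
        p₂ : F₀ D.t (F₀ u₂ j₁) ≡ F₀ u b
        p₂ = trans (sym (eq₀ commutes j₁)) (cong (F₀ u) p₁)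
        m : J.Hom (F₀ u₂ j₁) j
        m = J.eqHom e J.∘ F₁ u₂ l
        square : F₁ D.t m A.∘ A.eqHom (sym p₂) ≡ A.eqHom (sym p) A.∘ F₁ u f
        square = begin
          F₁ D.t (J.eqHom e J.∘ F₁ u₂ l) A.∘ A.eqHom (sym p₂)
            ≡⟨ A.∘-congʳ (F-∘ D.t _ _) ⟩
          (F₁ D.t (J.eqHom e) A.∘ F₁ D.t (F₁ u₂ l)) A.∘ A.eqHom (sym p₂)
            ≡⟨ A.assoc _ _ _ ⟩
          F₁ D.t (J.eqHom e) A.∘ (F₁ D.t (F₁ u₂ l) A.∘ A.eqHom (sym p₂))
            ≡⟨ cong₂ A._∘_ (Functor.F-eqHom D.t e (cong (F₀ D.t) e))
                 (A.∘-congˡ (sym (A.eqHom-comp (eq₀ commutes j₁) (sym (cong (F₀ u) p₁)) (sym p₂)))) ⟩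
          A.eqHom (cong (F₀ D.t) e) A.∘ (F₁ D.t (F₁ u₂ l) A.∘ (eqF commutes j₁ A.∘ A.eqHom (sym (cong (F₀ u) p₁))))
            ≡⟨ A.∘-congˡ (trans (sym (A.assoc _ _ _)) (trans (A.∘-congʳ (sym (eqF-natural commutes l))) (A.assoc _ _ _))) ⟩
          A.eqHom (cong (F₀ D.t) e) A.∘ (eqF commutes j′ A.∘ (F₁ u (F₁ D′.t l) A.∘ A.eqHom (sym (cong (F₀ u) p₁))))
            ≡⟨ cong (λ x → A.eqHom (cong (F₀ D.t) e) A.∘ (eqF commutes j′ A.∘ (F₁ u (F₁ D′.t l) A.∘ x)))
                 (sym (Functor.F-eqHom u (sym p₁) (sym (cong (F₀ u) p₁)))) ⟩
          A.eqHom (cong (F₀ D.t) e) A.∘ (eqF commutes j′ A.∘ (F₁ u (F₁ D′.t l) A.∘ F₁ u (A′.eqHom (sym p₁))))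
            ≡⟨ cong (λ x → A.eqHom (cong (F₀ D.t) e) A.∘ (eqF commutes j′ A.∘ x))
                 (trans (sym (F-∘ u _ _)) (trans (cong (F₁ u) q₁) (F-∘ u _ _))) ⟩
          A.eqHom (cong (F₀ D.t) e) A.∘ (eqF commutes j′ A.∘ (F₁ u (A′.eqHom (sym p′)) A.∘ F₁ u f))
            ≡⟨ cong (λ x → A.eqHom (cong (F₀ D.t) e) A.∘ (eqF commutes j′ A.∘ (x A.∘ F₁ u f)))
                 (Functor.F-eqHom u (sym p′) (cong (F₀ u) (sym p′))) ⟩
          A.eqHom (cong (F₀ D.t) e) A.∘ (eqF commutes j′ A.∘ (A.eqHom (cong (F₀ u) (sym p′)) A.∘ F₁ u f))
            ≡⟨ trans (A.∘-congˡ (sym (A.assoc _ _ _))) (sym (A.assoc _ _ _)) ⟩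
          (A.eqHom (cong (F₀ D.t) e) A.∘ (eqF commutes j′ A.∘ A.eqHom (cong (F₀ u) (sym p′)))) A.∘ F₁ u f
            ≡⟨ A.∘-congʳ (trans (A.∘-congˡ (A.eqHom-∘ _ _)) (A.eqHom-comp _ _ (sym p))) ⟩
          A.eqHom (sym p) A.∘ F₁ u f ∎
        along-m : ∀ i k → m J.∘ along refl k ≡ along {i} e (l J′.∘ k)
        along-m i k = begin
          (J.eqHom e J.∘ F₁ u₂ l) J.∘ ((J.eqHom refl J.∘ F₁ u₂ k) J.∘ eqF (sym q-square) i)
            ≡⟨ cong (λ x → (J.eqHom e J.∘ F₁ u₂ l) J.∘ (x J.∘ eqF (sym q-square) i))
                 (trans (J.∘-congʳ (J.eqHom-id refl)) (J.idˡ _)) ⟩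
          (J.eqHom e J.∘ F₁ u₂ l) J.∘ (F₁ u₂ k J.∘ eqF (sym q-square) i)
            ≡⟨ sym (J.assoc _ _ _) ⟩
          ((J.eqHom e J.∘ F₁ u₂ l) J.∘ F₁ u₂ k) J.∘ eqF (sym q-square) i
            ≡⟨ J.∘-congʳ (trans (J.assoc _ _ _) (J.∘-congˡ (sym (F-∘ u₂ l k)))) ⟩
          (J.eqHom e J.∘ F₁ u₂ (l J′.∘ k)) J.∘ eqF (sym q-square) i ∎
        fams : reindex X {j₁} refl (ran-map D.q ((D.s ^*) X) m n) ≡ ran-map D′.q X′ l (reindex X e n)
        fams = Ran-≡ D′.q X′
          (λ i k → cong (λ h → res X (eqF s-square i) (fam n (F₀ u₁ i) h)) (along-m i k))

    -- The mate of τ: u_* F[D′] ε · u_* τ u_* · η F[D] u_*.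
    σ : (X : Presheaf A′) → F[ D ] ((u ₊) X) ⇒ (u ₊) (F[ D′ ] X)
    σ X = (u ₊₁) (F[ D′ ]₁ (counit u X)) ∙ ((u ₊₁) (τ ((u ₊) X)) ∙ unit u (F[ D ] ((u ₊) X)))

    Coalg : ∀ C → Coalgebra D C → Coalgebra D′ ((u ^*) C)
    Coalg C c = τ C ∙ (u ^*₁) c

    Alg : ∀ Ω → Algebra D′ Ω → Algebra D ((u ₊) Ω)
    Alg Ω a = (u ₊₁) a ∙ σ Ω

  module Grothendieck {R : SmallCategory} (ar : Functor R Cats) where
    private module R = Category R

    Ar : R.Obj → SmallCategory
    Ar = F₀ ar

    ar₀ : ∀ {r r′} → R.Hom r r′ → Obj (Ar r) → Obj (Ar r′)
    ar₀ h = F₀ (F₁ ar h)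

    ar₁ : ∀ {r r′} (h : R.Hom r r′) {i j} → Hom (Ar r) i j → Hom (Ar r′) (ar₀ h i) (ar₀ h j)
    ar₁ h = F₁ (F₁ ar h)

    infixr 9 _⊙_
    _⊙_ : ∀ {r x y z} → Hom (Ar r) y z → Hom (Ar r) x y → Hom (Ar r) x z
    _⊙_ {r} = Category._∘_ (Ar r)
    private module Ar {r} = Category (Ar r)

    ∫Obj : Set ℓ
    ∫Obj = Σ[ r ∈ R.Obj ] Obj (Ar r)

    ∫Hom : ∫Obj → ∫Obj → Set ℓ
    ∫Hom (r , i) (r′ , i′) = Σ[ h ∈ R.Hom r r′ ] Hom (Ar r′) (ar₀ h i) i′

    to-id : ∀ {r} i → Hom (Ar r) (ar₀ R.id i) i
    to-id = eqF (F-id ar)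

    to-∘ : ∀ {r r′ r″} (h′ : R.Hom r′ r″) (h : R.Hom r r′) i → Hom (Ar r″) (ar₀ (h′ R.∘ h) i) (ar₀ h′ (ar₀ h i))
    to-∘ h′ h = eqF (F-∘ ar h′ h)

    comp : ∀ {x y z} → ∫Hom y z → ∫Hom x y → ∫Hom x z
    comp {_ , i} (h′ , l′) (h , l) = h′ R.∘ h , l′ ⊙ (ar₁ h′ l ⊙ to-∘ h′ h i)

    ∫-≡ : ∀ {r r′} {i : Obj (Ar r)} {i′ : Obj (Ar r′)} {h k : R.Hom r r′}
          {l : Hom (Ar r′) (ar₀ h i) i′} {m : Hom (Ar r′) (ar₀ k i) i′} (e : h ≡ k)
          (e′ : ar₀ h i ≡ ar₀ k i) → l ≡ m ⊙ Ar.eqHom e′ →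
          _≡_ {A = ∫Hom (r , i) (r′ , i′)} (h , l) (k , m)
    ∫-≡ refl e′ q = cong (_ ,_) (trans q (trans (Ar.∘-congˡ (Ar.eqHom-id e′)) (Ar.idʳ _)))

    ar₁-eqHom : ∀ {r r′} (h : R.Hom r r′) {x y} (p : x ≡ y) → ar₁ h (Ar.eqHom p) ≡ Ar.eqHom (cong (ar₀ h) p)
    ar₁-eqHom h p = Functor.F-eqHom (F₁ ar h) p _

    ∫ar : SmallCategory
    ∫ar = record
      { Obj   = ∫Obj
      ; Hom   = ∫Hom
      ; id    = R.id , to-id _
      ; _∘_   = comp
      ; idˡ   = left
      ; idʳ   = right
      ; assoc = associative }
      where
      left : ∀ {x y} (f : ∫Hom x y) → comp (R.id , to-id _) f ≡ f
      left {_ , i} (h , l) = ∫-≡ (R.idˡ h) (cong (λ h → ar₀ h i) (R.idˡ h)) (begin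
        to-id _ ⊙ (ar₁ R.id l ⊙ to-∘ R.id h i)   ≡⟨ sym (Ar.assoc _ _ _) ⟩
        (to-id _ ⊙ ar₁ R.id l) ⊙ to-∘ R.id h i   ≡⟨ Ar.∘-congʳ (eqF-natural (F-id ar) l) ⟩
        (l ⊙ to-id _) ⊙ to-∘ R.id h i            ≡⟨ Ar.assoc _ _ _ ⟩
        l ⊙ (to-id _ ⊙ to-∘ R.id h i)            ≡⟨ Ar.∘-congˡ (Ar.eqHom-comp _ _ _) ⟩
        l ⊙ Ar.eqHom (cong (λ h → ar₀ h i) (R.idˡ h)) ∎)

      right : ∀ {x y} (f : ∫Hom x y) → comp f (R.id , to-id _) ≡ f
      right {_ , i} (h , l) = ∫-≡ (R.idʳ h) (cong (λ h → ar₀ h i) (R.idʳ h))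
        (Ar.∘-congˡ (trans (Ar.∘-congʳ (ar₁-eqHom h _)) (Ar.eqHom-comp _ _ _)))

      associative : ∀ {w x y z} (f : ∫Hom y z) (g : ∫Hom x y) (k : ∫Hom w x) →
                    comp (comp f g) k ≡ comp f (comp g k)
      associative {_ , i} {_ , i₁} (h₃ , l₃) (h₂ , l₂) (h₁ , l₁) =
        ∫-≡ (R.assoc h₃ h₂ h₁) (cong (λ h → ar₀ h i) (R.assoc h₃ h₂ h₁)) (begin
        (l₃ ⊙ (ar₁ h₃ l₂ ⊙ to-∘ h₃ h₂ i₁)) ⊙ (ar₁ (h₃ R.∘ h₂) l₁ ⊙ to-∘ (h₃ R.∘ h₂) h₁ i)
          ≡⟨ trans (Ar.assoc _ _ _) (Ar.∘-congˡ (Ar.assoc _ _ _)) ⟩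
        l₃ ⊙ (ar₁ h₃ l₂ ⊙ (to-∘ h₃ h₂ i₁ ⊙ (ar₁ (h₃ R.∘ h₂) l₁ ⊙ to-∘ (h₃ R.∘ h₂) h₁ i)))
          ≡⟨ cong (λ x → l₃ ⊙ (ar₁ h₃ l₂ ⊙ x))
               (trans (sym (Ar.assoc _ _ _)) (trans (Ar.∘-congʳ (eqF-natural (F-∘ ar h₃ h₂) l₁)) (Ar.assoc _ _ _))) ⟩
        l₃ ⊙ (ar₁ h₃ l₂ ⊙ (ar₁ h₃ (ar₁ h₂ l₁) ⊙ (to-∘ h₃ h₂ (ar₀ h₁ i) ⊙ to-∘ (h₃ R.∘ h₂) h₁ i)))
          ≡⟨ cong (λ x → l₃ ⊙ (ar₁ h₃ l₂ ⊙ (ar₁ h₃ (ar₁ h₂ l₁) ⊙ x)))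
               (trans (Ar.eqHom-∘ _ _) (sym (trans (Ar.∘-congʳ (ar₁-eqHom h₃ _))
                 (trans (Ar.∘-congˡ (Ar.eqHom-∘ _ _)) (Ar.eqHom-comp _ _ _))))) ⟩
        l₃ ⊙ (ar₁ h₃ l₂ ⊙ (ar₁ h₃ (ar₁ h₂ l₁) ⊙
               (ar₁ h₃ (to-∘ h₂ h₁ i) ⊙ (to-∘ h₃ (h₂ R.∘ h₁) i ⊙ assoc-eq))))
          ≡⟨ cong (λ x → l₃ ⊙ (ar₁ h₃ l₂ ⊙ x)) (sym (Ar.assoc _ _ _)) ⟩
        l₃ ⊙ (ar₁ h₃ l₂ ⊙ ((ar₁ h₃ (ar₁ h₂ l₁) ⊙ ar₁ h₃ (to-∘ h₂ h₁ i)) ⊙ (to-∘ h₃ (h₂ R.∘ h₁) i ⊙ assoc-eq)))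
          ≡⟨ Ar.∘-congˡ (sym (Ar.assoc _ _ _)) ⟩
        l₃ ⊙ ((ar₁ h₃ l₂ ⊙ (ar₁ h₃ (ar₁ h₂ l₁) ⊙ ar₁ h₃ (to-∘ h₂ h₁ i))) ⊙ (to-∘ h₃ (h₂ R.∘ h₁) i ⊙ assoc-eq))
          ≡⟨ cong (λ x → l₃ ⊙ (x ⊙ (to-∘ h₃ (h₂ R.∘ h₁) i ⊙ assoc-eq)))
               (sym (trans (F-∘ (F₁ ar h₃) _ _) (Ar.∘-congˡ (F-∘ (F₁ ar h₃) _ _)))) ⟩
        l₃ ⊙ (ar₁ h₃ (l₂ ⊙ (ar₁ h₂ l₁ ⊙ to-∘ h₂ h₁ i)) ⊙ (to-∘ h₃ (h₂ R.∘ h₁) i ⊙ assoc-eq))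
          ≡⟨ trans (Ar.∘-congˡ (sym (Ar.assoc _ _ _))) (sym (Ar.assoc _ _ _)) ⟩
        (l₃ ⊙ (ar₁ h₃ (l₂ ⊙ (ar₁ h₂ l₁ ⊙ to-∘ h₂ h₁ i)) ⊙ to-∘ h₃ (h₂ R.∘ h₁) i)) ⊙ assoc-eq ∎)
        where
        assoc-eq = Ar.eqHom (cong (λ h → ar₀ h i) (R.assoc h₃ h₂ h₁))

    private module ∫ar = Category ∫ar

    q-ar : Functor ∫ar R
    q-ar = record { F₀ = proj₁ ; F₁ = proj₁ ; F-id = refl ; F-∘ = λ _ _ → refl }

    opcartesian : ∀ {r r′} (h : R.Hom r r′) i → ∫ar.Hom (r , i) (r′ , ar₀ h i)
    opcartesian h i = h , Ar.id

    ι₁ : ∀ {r i j} → Hom (Ar r) i j → ∫ar.Hom (r , i) (r , j)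
    ι₁ l = R.id , l ⊙ to-id _

    ι-opcartesian : ∀ {r r′} (h : R.Hom r r′) {i i′} (l : Hom (Ar r′) (ar₀ h i) i′) →
                    ι₁ l ∫ar.∘ opcartesian h i ≡ (h , l)
    ι-opcartesian h {i} l = ∫-≡ (R.idˡ h) (cong (λ h → ar₀ h i) (R.idˡ h)) (begin
      (l ⊙ to-id _) ⊙ (ar₁ R.id Ar.id ⊙ to-∘ R.id h i)
        ≡⟨ cong (λ x → (l ⊙ to-id _) ⊙ (x ⊙ to-∘ R.id h i)) (F-id (F₁ ar R.id)) ⟩
      (l ⊙ to-id _) ⊙ (Ar.id ⊙ to-∘ R.id h i)
        ≡⟨ trans (Ar.∘-congˡ (Ar.idˡ _)) (Ar.assoc _ _ _) ⟩
      l ⊙ (to-id _ ⊙ to-∘ R.id h i)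
        ≡⟨ Ar.∘-congˡ (Ar.eqHom-comp _ _ _) ⟩
      l ⊙ Ar.eqHom (cong (λ h → ar₀ h i) (R.idˡ h)) ∎)

    opcartesian-natural : ∀ {r r′} (h : R.Hom r r′) {i j} (l : Hom (Ar r) i j) →
                          ι₁ (ar₁ h l) ∫ar.∘ opcartesian h i ≡ opcartesian h j ∫ar.∘ ι₁ l
    opcartesian-natural h {i} l = trans (ι-opcartesian h (ar₁ h l)) (sym
      (∫-≡ (R.idʳ h) (cong (λ h → ar₀ h i) (R.idʳ h)) (begin
      Ar.id ⊙ (ar₁ h (l ⊙ to-id _) ⊙ to-∘ h R.id i)
        ≡⟨ trans (Ar.idˡ _) (Ar.∘-congʳ (F-∘ (F₁ ar h) _ _)) ⟩
      (ar₁ h l ⊙ ar₁ h (to-id _)) ⊙ to-∘ h R.id i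
        ≡⟨ Ar.assoc _ _ _ ⟩
      ar₁ h l ⊙ (ar₁ h (to-id _) ⊙ to-∘ h R.id i)
        ≡⟨ Ar.∘-congˡ (trans (Ar.∘-congʳ (ar₁-eqHom h _)) (Ar.eqHom-comp _ _ _)) ⟩
      ar₁ h l ⊙ Ar.eqHom (cong (λ h → ar₀ h i) (R.idʳ h)) ∎)))

    -- The fibre over r is ar r.
    ι : ∀ r → Functor (Ar r) ∫ar
    ι r = record
      { F₀   = λ i → r , i
      ; F₁   = ι₁
      ; F-id = cong (R.id ,_) (Ar.idˡ _)
      ; F-∘  = λ m l → sym (∫-≡ (R.idˡ R.id) (cong (λ h → ar₀ h _) (R.idˡ R.id)) (begin
          (m ⊙ to-id _) ⊙ (ar₁ R.id (l ⊙ to-id _) ⊙ to-∘ R.id R.id _)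
            ≡⟨ trans (Ar.assoc _ _ _) (Ar.∘-congˡ (sym (Ar.assoc _ _ _))) ⟩
          m ⊙ ((to-id _ ⊙ ar₁ R.id (l ⊙ to-id _)) ⊙ to-∘ R.id R.id _)
            ≡⟨ cong (λ x → m ⊙ (x ⊙ to-∘ R.id R.id _)) (eqF-natural (F-id ar) _) ⟩
          m ⊙ (((l ⊙ to-id _) ⊙ to-id _) ⊙ to-∘ R.id R.id _)
            ≡⟨ Ar.∘-congˡ (trans (Ar.assoc _ _ _) (Ar.assoc _ _ _)) ⟩
          m ⊙ (l ⊙ (to-id _ ⊙ (to-id _ ⊙ to-∘ R.id R.id _)))
            ≡⟨ cong (λ x → m ⊙ (l ⊙ x)) (trans (Ar.∘-congˡ (Ar.eqHom-∘ _ _))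
                 (trans (Ar.eqHom-∘ _ _) (sym (Ar.eqHom-comp _ _ _)))) ⟩
          m ⊙ (l ⊙ (to-id _ ⊙ Ar.eqHom (cong (λ h → ar₀ h _) (R.idˡ R.id))))
            ≡⟨ trans (Ar.∘-congˡ (sym (Ar.assoc _ _ _))) (trans (sym (Ar.assoc _ _ _)) (Ar.∘-congʳ (sym (Ar.assoc _ _ _)))) ⟩
          ((m ⊙ l) ⊙ to-id _) ⊙ Ar.eqHom (cong (λ h → ar₀ h _) (R.idˡ R.id)) ∎)) }

  record ProofSystem (Jdg : SmallCategory) : Set (suc ℓ) where
    no-eta-equality
    field
      R  : SmallCategory
      ar : Functor R Cats

    open Grothendieck ar public

    field
      prem          : Functor ∫ar Jdg
      ccl           : Functor R Jdg
      ccl-fibration : DiscreteFibration ccl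

    diagram : Diagram Jdg
    diagram = record { I = ∫ar ; J = R ; s = prem ; q = q-ar ; t = ccl ; t-fibration = ccl-fibration }

    -- prem-opcartesian says that prem (r , i) = prem (r′ , ar(h)(i)), and
    -- that the canonical opcartesian arrow between these objects, being the
    -- lift of h provided by two-sidedness, is sent to the identity.
    field
      isPolynomial     : IsPolynomial diagram
      prem-opcartesian : ∀ {r r′} (h : Hom R r r′) (i : Obj (Ar r)) →
                         mapOutOf prem ((r′ , ar₀ h i) , opcartesian h i) ≡
                         (F₀ prem (r , i) , Category.id Jdg)

    prem-≡ : ∀ {r r′} (h : Hom R r r′) (i : Obj (Ar r)) → F₀ prem (r , i) ≡ F₀ prem (r′ , ar₀ h i)
    prem-≡ h i = sym (cong proj₁ (prem-opcartesian h i))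

    prem-eqHom : ∀ {r r′} (h : Hom R r r′) (i : Obj (Ar r)) →
                 F₁ prem (opcartesian h i) ≡ eqHom Jdg (prem-≡ h i)
    prem-eqHom h i = go (prem-opcartesian h i)
      where
      open Category Jdg using (eqHom-id)
      go : ∀ {a} {v : OutOf Jdg a} (e : v ≡ (a , Category.id Jdg)) → proj₂ v ≡ eqHom Jdg (sym (cong proj₁ e))
      go refl = sym (eqHom-id refl)

  -- A formula φ ∈ fml(s) occurs below as the object (s , φ) of ∫ fml.
  record TraceStructure {Jdg : SmallCategory} (P : ProofSystem Jdg) : Set (suc ℓ) where
    no-eta-equality
    private module P = ProofSystem P
    field
      fml        : Presheaf Jdg
      T          : ProofSystem (∫ fml)
      projection : VMorphism (π fml) (ProofSystem.diagram T) P.diagram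

    private module T = ProofSystem T
    open VMorphism projection

    Step : Obj P.∫ar → Obj (∫ fml) → Obj (∫ fml) → Set ℓ
    Step ri Φ Ψ = Σ[ i′ ∈ Obj T.∫ar ]
      F₀ u₁ i′ ≡ ri × F₀ T.prem i′ ≡ Ψ × F₀ T.ccl (F₀ T.q-ar i′) ≡ Φ

    field
      Prog      : Obj P.∫ar → Obj (∫ fml) → Obj (∫ fml) → Set ℓ
      Prog⇒Step : ∀ {ri Φ Ψ} → Prog ri Φ Ψ → Step ri Φ Ψ
      Step-pull : ∀ {r₁ r₂} (h : Hom P.R r₁ r₂) (i : Obj (P.Ar r₁))
                  (φ : El fml (F₀ P.ccl r₂)) (ψ : El fml (F₀ P.prem (r₂ , P.ar₀ h i))) →
                  Step (r₂ , P.ar₀ h i) (F₀ P.ccl r₂ , φ) (_ , ψ) →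
                  Step (r₁ , i) (F₀ P.ccl r₁ , res fml (F₁ P.ccl h) φ) (_ , ψ)
      Prog-pull : ∀ {r₁ r₂} (h : Hom P.R r₁ r₂) (i : Obj (P.Ar r₁))
                  (φ : El fml (F₀ P.ccl r₂)) (ψ : El fml (F₀ P.prem (r₂ , P.ar₀ h i))) →
                  Prog (r₂ , P.ar₀ h i) (F₀ P.ccl r₂ , φ) (_ , ψ) →
                  Prog (r₁ , i) (F₀ P.ccl r₁ , res fml (F₁ P.ccl h) φ) (_ , ψ)

  PreProof : ∀ {Jdg} → ProofSystem Jdg → Presheaf Jdg → Set ℓ
  PreProof P C = Coalgebra (ProofSystem.diagram P) C

  module LabelledGraph {Jdg : SmallCategory} (P : ProofSystem Jdg) {C : Presheaf Jdg} (c : PreProof P C) where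
    open ProofSystem P

    Node : Set ℓ
    Node = Obj (∫ C)

    rule : Node → Obj R
    rule (s , n) = proj₁ (at c s n)

    child : (x : Node) → Obj (Ar (rule x)) → Node
    child x@(s , n) i = F₀ prem (rule x , i) , fam (proj₂ (proj₂ (at c s n))) (rule x , i) (Category.id R)

    record Path : Set ℓ where
      field
        node  : ℕ → Node
        label : ∀ k → Obj (Ar (rule (node k)))
        edge  : ∀ k → node (ℕ.suc k) ≡ child (node k) (label k)

    open Path

    suffix : ℕ → Path → Path
    suffix m p = record
      { node  = λ k → node p (k ℕ.+ m)
      ; label = λ k → label p (k ℕ.+ m)
      ; edge  = λ k → edge p (k ℕ.+ m) }

    module _ (tr : TraceStructure P) where
      open TraceStructure tr

      record Trace (p : Path) : Set ℓ where
        formulaAt : ((k : ℕ) → El fml (proj₁ (node p k))) → ℕ → Obj (∫ fml)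
        formulaAt φ k = proj₁ (node p k) , φ k
        field
          formula : ∀ k → El fml (proj₁ (node p k))
          step    : ∀ k → Step (rule (node p k) , label p k) (formulaAt formula k) (formulaAt formula (ℕ.suc k))

        InfinitelyProgressing : Set ℓ
        InfinitelyProgressing = ∀ N → ∃[ k ] N ℕ.≤ k ×
          Prog (rule (node p k) , label p k) (formulaAt formula k) (formulaAt formula (ℕ.suc k))

      GlobalTraceCondition : Set ℓ
      GlobalTraceCondition = (p : Path) → ∃[ m ] ∃ λ (t : Trace (suffix m p)) → Trace.InfinitelyProgressing t

  module Annotation {Jdg : SmallCategory} (P : ProofSystem Jdg) (tr : TraceStructure P) (γ : Ordinal ℓ) where
    open ProofSystem P
    open TraceStructure tr using (fml; Step; Prog; Step-pull; Prog-pull)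
    open Ordinal γ using (_<_; _≤_; ≤-reflexive; ≤-trans; <-≤-trans)
    private
      module Jdg = Category Jdg
      module R = Category R
      module ∫ar = Category ∫ar

    Label : Jdg.Obj → Set ℓ
    Label s = El fml s → Ordinal.Carrier γ

    relabel : ∀ {s s′} → s ≡ s′ → Label s → Label s′
    relabel = subst Label

    Monotone : ∀ {s₁ s₂} → Jdg.Hom s₁ s₂ → Label s₁ → Label s₂ → Set ℓ
    Monotone {s₂ = s₂} h f₁ f₂ = (φ : El fml s₂) → f₁ (res fml h φ) ≤ f₂ φ

    relabel-eqHom : ∀ {s s′} (e : s ≡ s′) (f : Label s) ψ → relabel e f ψ ≡ f (res fml (Jdg.eqHom e) ψ)
    relabel-eqHom refl f ψ =
      cong f (sym (trans (cong (λ h → res fml h ψ) (Jdg.eqHom-id refl)) (res-id fml ψ)))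

    relabel-trans : ∀ {s s′ s″} (e : s ≡ s′) (e′ : s′ ≡ s″) (e″ : s ≡ s″) (f : Label s) →
                    relabel e′ (relabel e f) ≡ relabel e″ f
    relabel-trans refl refl refl f = refl

    monotone-id : ∀ {s} (f : Label s) → Monotone Jdg.id f f
    monotone-id f φ = ≤-reflexive (cong f (res-id fml φ))

    monotone-∘ : ∀ {s₁ s₂ s₃} {f₁ : Label s₁} {f₂ : Label s₂} {f₃ : Label s₃}
                 (g : Jdg.Hom s₂ s₃) (h : Jdg.Hom s₁ s₂) →
                 Monotone g f₂ f₃ → Monotone h f₁ f₂ → Monotone (g Jdg.∘ h) f₁ f₃
    monotone-∘ {f₁ = f₁} g h m n φ =
      ≤-trans (≤-reflexive (cong f₁ (res-∘ fml g h φ))) (≤-trans (n _) (m φ))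

    monotone-≡ : ∀ {s₁ s₂} {f₁ : Label s₁} {f₂ : Label s₂} {g h : Jdg.Hom s₁ s₂} →
                 g ≡ h → Monotone g f₁ f₂ → Monotone h f₁ f₂
    monotone-≡ refl m = m

    -- Objects of B labelled, over a functor K : B → Jdg, with admissible
    -- functions fml(K b) → γ; arrows of B that are monotone for the labels.
    -- The conditions are irrelevant, so that only the underlying data count
    -- for equality.
    module _ {B : SmallCategory} (K : Functor B Jdg) (Admissible : ∀ b → Label (F₀ K b) → Set ℓ) where
      private module B = Category B

      record LabelledObj : Set ℓ where
        constructor labelled
        field
          base        : B.Obj
          label       : Label (F₀ K base)
          .admissible : Admissible base label

      record LabelledHom (x y : LabelledObj) : Set ℓ where
        constructor labelledHom
        open LabelledObj
        field
          hom       : B.Hom (base x) (base y)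
          .monotone : Monotone (F₁ K hom) (label x) (label y)

      open LabelledObj
      open LabelledHom

      labelledHom-≡ : ∀ {x y} {f g : LabelledHom x y} → hom f ≡ hom g → f ≡ g
      labelledHom-≡ {f = labelledHom _ _} {labelledHom _ _} refl = refl

      labelledObj-≡ : ∀ {x y} (e : base x ≡ base y) → relabel (cong (F₀ K) e) (label x) ≡ label y → x ≡ y
      labelledObj-≡ {labelled _ _ _} {labelled _ _ _} refl refl = refl

      Labelled : SmallCategory
      Labelled = record
        { Obj   = LabelledObj
        ; Hom   = LabelledHom
        ; id    = λ {x} → labelledHom B.id (monotone-≡ {f₁ = label x} {label x} (sym (F-id K)) (monotone-id (label x)))
        ; _∘_   = λ {x} {y} {z} (labelledHom g m) (labelledHom h n) → labelledHom (g B.∘ h)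
                    (monotone-≡ {f₁ = label x} {label z} (sym (F-∘ K g h))
                      (monotone-∘ {f₁ = label x} {label y} {label z} (F₁ K g) (F₁ K h) m n))
        ; idˡ   = λ f → labelledHom-≡ (B.idˡ (hom f))
        ; idʳ   = λ f → labelledHom-≡ (B.idʳ (hom f))
        ; assoc = λ f g k → labelledHom-≡ (B.assoc (hom f) (hom g) (hom k)) }

      forget : Functor Labelled B
      forget = record { F₀ = base ; F₁ = hom ; F-id = refl ; F-∘ = λ _ _ → refl }

      labelledArr-≡ : ∀ {x x′ y y′} {f : LabelledHom x y} {f′ : LabelledHom x′ y′} → x ≡ x′ → y ≡ y′ →
                      B.arr (hom f) ≡ B.arr (hom f′) → arr Labelled f ≡ arr Labelled f′
      labelledArr-≡ refl refl e = cong (arr Labelled) (labelledHom-≡ (B.arr-injective e))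

    open LabelledObj
    open LabelledHom

    Any : ∀ {B : SmallCategory} (K : Functor B Jdg) b → Label (F₀ K b) → Set ℓ
    Any _ _ _ = ⊤

    Jdgγ : SmallCategory
    Jdgγ = Labelled idF (Any idF)

    Rγ : SmallCategory
    Rγ = Labelled ccl (Any ccl)

    Admissible : ∀ r → Label (F₀ ccl r) → ∀ i → Label (F₀ prem (r , i)) → Set ℓ
    Admissible r f i g = ∀ φ ψ →
      (Step (r , i) (F₀ ccl r , φ) (F₀ prem (r , i) , ψ) → g ψ ≤ f φ) ×
      (Prog (r , i) (F₀ ccl r , φ) (F₀ prem (r , i) , ψ) → g ψ < f φ)

    Arγ : Obj Rγ → SmallCategory
    Arγ (labelled r f _) = Labelled (prem ∘F ι r) (Admissible r f)

    push-admissible : ∀ {r₁ r₂} (h : R.Hom r₁ r₂) {f₁ f₂} → Monotone (F₁ ccl h) f₁ f₂ →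
                      ∀ i g → Admissible r₁ f₁ i g → Admissible r₂ f₂ (ar₀ h i) (relabel (prem-≡ h i) g)
    push-admissible {r₁} h {f₁} m i g a φ ψ =
      (λ st → ≤-trans (go≤ (prem-≡ h i) ψ (Step-pull h i φ ψ st)) (m φ)) ,
      (λ pr → <-≤-trans (go< (prem-≡ h i) ψ (Prog-pull h i φ ψ pr)) (m φ))
      where
      φ′ = res fml (F₁ ccl h) φ
      go≤ : ∀ {s} (e : F₀ prem (r₁ , i) ≡ s) ψ → Step (r₁ , i) (F₀ ccl r₁ , φ′) (s , ψ) → relabel e g ψ ≤ f₁ φ′
      go≤ refl ψ = proj₁ (a φ′ ψ)
      go< : ∀ {s} (e : F₀ prem (r₁ , i) ≡ s) ψ → Prog (r₁ , i) (F₀ ccl r₁ , φ′) (s , ψ) → relabel e g ψ < f₁ φ′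
      go< refl ψ = proj₂ (a φ′ ψ)

    push-monotone : ∀ {r₁ r₂} (h : R.Hom r₁ r₂) {i j} (l : Hom (Ar r₁) i j) {f g} →
                    Monotone (F₁ prem (F₁ (ι r₁) l)) f g →
                    Monotone (F₁ prem (F₁ (ι r₂) (ar₁ h l))) (relabel (prem-≡ h i) f) (relabel (prem-≡ h j) g)
    push-monotone {r₁} {r₂} h {i} {j} l {f} {g} m ψ =
      ≤-trans (≤-reflexive (begin
        relabel (prem-≡ h i) f (res fml (F₁ prem (F₁ (ι r₂) (ar₁ h l))) ψ)
          ≡⟨ relabel-eqHom (prem-≡ h i) f _ ⟩
        f (res fml (Jdg.eqHom (prem-≡ h i)) (res fml (F₁ prem (F₁ (ι r₂) (ar₁ h l))) ψ))
          ≡⟨ cong f (sym (res-∘ fml _ _ ψ)) ⟩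
        f (res fml (F₁ prem (F₁ (ι r₂) (ar₁ h l)) Jdg.∘ Jdg.eqHom (prem-≡ h i)) ψ)
          ≡⟨ cong (λ k → f (res fml k ψ)) square ⟩
        f (res fml (Jdg.eqHom (prem-≡ h j) Jdg.∘ F₁ prem (F₁ (ι r₁) l)) ψ)
          ≡⟨ cong f (res-∘ fml _ _ ψ) ⟩
        f (res fml (F₁ prem (F₁ (ι r₁) l)) (res fml (Jdg.eqHom (prem-≡ h j)) ψ)) ∎))
      (≤-trans (m _) (≤-reflexive (sym (relabel-eqHom (prem-≡ h j) g ψ))))
      where
      square : F₁ prem (F₁ (ι r₂) (ar₁ h l)) Jdg.∘ Jdg.eqHom (prem-≡ h i) ≡
               Jdg.eqHom (prem-≡ h j) Jdg.∘ F₁ prem (F₁ (ι r₁) l)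
      square = begin
        F₁ prem (F₁ (ι r₂) (ar₁ h l)) Jdg.∘ Jdg.eqHom (prem-≡ h i)
          ≡⟨ Jdg.∘-congˡ (sym (prem-eqHom h i)) ⟩
        F₁ prem (F₁ (ι r₂) (ar₁ h l)) Jdg.∘ F₁ prem (opcartesian h i)
          ≡⟨ sym (F-∘ prem _ _) ⟩
        F₁ prem (F₁ (ι r₂) (ar₁ h l) ∫ar.∘ opcartesian h i)
          ≡⟨ cong (F₁ prem) (opcartesian-natural h l) ⟩
        F₁ prem (opcartesian h j ∫ar.∘ F₁ (ι r₁) l)
          ≡⟨ F-∘ prem _ _ ⟩
        F₁ prem (opcartesian h j) Jdg.∘ F₁ prem (F₁ (ι r₁) l)
          ≡⟨ Jdg.∘-congʳ (prem-eqHom h j) ⟩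
        Jdg.eqHom (prem-≡ h j) Jdg.∘ F₁ prem (F₁ (ι r₁) l) ∎

    compose-monotone : ∀ {r₁ r₂} (h : R.Hom r₁ r₂) {i i′} (l : Hom (Ar r₂) (ar₀ h i) i′) {f g} →
                       Monotone (F₁ prem (F₁ (ι r₂) l)) (relabel (prem-≡ h i) f) g →
                       Monotone (F₁ prem (h , l)) f g
    compose-monotone {r₂ = r₂} h {i} l {f} {g} m ψ = ≤-trans (≤-reflexive (begin
      f (res fml (F₁ prem (h , l)) ψ)
        ≡⟨ cong (λ k → f (res fml (F₁ prem k) ψ)) (sym (ι-opcartesian h l)) ⟩
      f (res fml (F₁ prem (F₁ (ι r₂) l ∫ar.∘ opcartesian h i)) ψ)
        ≡⟨ cong (λ k → f (res fml k ψ)) (trans (F-∘ prem _ _) (Jdg.∘-congˡ (prem-eqHom h i))) ⟩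
      f (res fml (F₁ prem (F₁ (ι r₂) l) Jdg.∘ Jdg.eqHom (prem-≡ h i)) ψ)
        ≡⟨ cong f (res-∘ fml _ _ ψ) ⟩
      f (res fml (Jdg.eqHom (prem-≡ h i)) (res fml (F₁ prem (F₁ (ι r₂) l)) ψ))
        ≡⟨ sym (relabel-eqHom (prem-≡ h i) f _) ⟩
      relabel (prem-≡ h i) f (res fml (F₁ prem (F₁ (ι r₂) l)) ψ) ∎)) (m ψ)

    -- The label g is carried unchanged along prem (r , i) ≡ prem (r′ , ar(h)(i)).
    arγ₁ : ∀ {x y} → Hom Rγ x y → Functor (Arγ x) (Arγ y)
    arγ₁ {labelled r₁ f₁ _} {labelled r₂ f₂ _} (labelledHom h m) = record
      { F₀   = λ (labelled i g a) → labelled (ar₀ h i) (relabel (prem-≡ h i) g) (push-admissible h m i g a)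
      ; F₁   = λ (labelledHom l n) → labelledHom (ar₁ h l) (push-monotone h l n)
      ; F-id = labelledHom-≡ _ _ (F-id (F₁ ar h))
      ; F-∘  = λ k l → labelledHom-≡ _ _ (F-∘ (F₁ ar h) (hom k) (hom l)) }

    arγ : Functor Rγ Cats
    arγ = record
      { F₀   = Arγ
      ; F₁   = arγ₁
      ; F-id = λ {x} → functor-≡ identity₀ λ {i} {j} l →
          labelledArr-≡ _ _ (identity₀ i) (identity₀ j) (mapArr-≡ (F-id ar) (hom l))
      ; F-∘  = λ g f → functor-≡ (compose₀ g f) λ {i} {j} l →
          labelledArr-≡ _ _ (compose₀ g f i) (compose₀ g f j) (mapArr-≡ (F-∘ ar (hom g) (hom f)) (hom l)) }
      where
      mapArr-≡ : ∀ {C D : SmallCategory} {F G : Functor C D} → F ≡ G →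
                 ∀ {x y} (f : Hom C x y) → arr D (F₁ F f) ≡ arr D (F₁ G f)
      mapArr-≡ refl f = refl
      identity₀ : ∀ {x} i → F₀ (arγ₁ (Category.id Rγ {x})) i ≡ i
      identity₀ {x} (labelled i g a) =
        labelledObj-≡ _ _ (eq₀ (F-id ar) i) (relabel-trans (prem-≡ R.id i) (cong (λ i → F₀ prem (_ , i)) (eq₀ (F-id ar) i)) refl g)
      compose₀ : ∀ {x y z} (g : Hom Rγ y z) (f : Hom Rγ x y) i →
                 F₀ (arγ₁ (Category._∘_ Rγ g f)) i ≡ F₀ (arγ₁ g) (F₀ (arγ₁ f) i)
      compose₀ g f (labelled i l a) =
        let e  = eq₀ (F-∘ ar (hom g) (hom f)) i
            p  = prem-≡ (hom f) i
            p′ = prem-≡ (hom g) (ar₀ (hom f) i)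
        in labelledObj-≡ _ _ e
             (trans (relabel-trans (prem-≡ (hom g R.∘ hom f) i) (cong (λ i → F₀ prem (_ , i)) e) (trans p p′) l)
                    (sym (relabel-trans p p′ (trans p p′) l)))

    private module γ = Grothendieck arγ

    u₁γ : Functor γ.∫ar ∫ar
    u₁γ = record
      { F₀   = λ (x , i) → base x , base i
      ; F₁   = λ (h , l) → hom h , hom l
      ; F-id = λ {(x , i)} → cong (R.id ,_) (Functor.F-eqHom (forget _ (Admissible (base x) (label x))) (eq₀ (F-id arγ {x}) i) (eq₀ (F-id ar) (base i)))
      ; F-∘  = λ {(x , i)} {_} {(z , _)} (g , m) (f , l) →
          cong (λ k → hom g R.∘ hom f , Category._∘_ (Ar (base z)) (hom m) (Category._∘_ (Ar (base z)) (ar₁ (hom g) (hom l)) k))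
               (Functor.F-eqHom (forget _ (Admissible (base z) (label z))) (eq₀ (F-∘ arγ g f) i) (eq₀ (F-∘ ar (hom g) (hom f)) (base i))) }

    premγ : Functor γ.∫ar Jdgγ
    premγ = record
      { F₀   = λ (x , i) → labelled (F₀ prem (base x , base i)) (label i) tt
      ; F₁   = λ (h , labelledHom l m) → labelledHom (F₁ prem (hom h , l)) (compose-monotone (hom h) l m)
      ; F-id = λ {(x , i)} → labelledHom-≡ _ _ (F-id (prem ∘F u₁γ) {x , i})
      ; F-∘  = λ g f → labelledHom-≡ _ _ (F-∘ (prem ∘F u₁γ) g f) }

    cclγ : Functor Rγ Jdgγ
    cclγ = record
      { F₀   = λ x → labelled (F₀ ccl (base x)) (label x) tt
      ; F₁   = λ (labelledHom h m) → labelledHom (F₁ ccl h) m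
      ; F-id = labelledHom-≡ _ _ (F-id ccl)
      ; F-∘  = λ g f → labelledHom-≡ _ _ (F-∘ ccl (hom g) (hom f)) }

    cclγ-fibration : DiscreteFibration cclγ
    cclγ-fibration (labelled r f _) {labelled s g _} (labelledHom h m) =
      let (l , e , unique) = ccl-fibration r h in lift l e unique m
      where
      Lifts : ∀ {s} (g : Label s) (h : Jdg.Hom s (F₀ ccl r)) → .(Monotone h g f) → Set ℓ
      Lifts {s} g h m = ∃! _≡_ λ (l : Into Rγ (labelled r f tt)) →
        mapInto cclγ l ≡ (labelled s g tt , labelledHom h m)
      injective : ∀ {r₀} {k : R.Hom r₀ r} {g : Label (F₀ ccl r₀)} .{m : Monotone (F₁ ccl k) g f}
                  (y : Into Rγ (labelled r f tt)) → (r₀ , k) ≡ mapInto (forget ccl (Any ccl)) y →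
                  mapInto cclγ y ≡ (labelled (F₀ ccl r₀) g tt , labelledHom (F₁ ccl k) m) →
                  (labelled r₀ g tt , labelledHom k m) ≡ y
      injective (labelled _ _ _ , labelledHom _ _) refl refl = refl
      lift : ∀ {s} {g : Label s} {h : Jdg.Hom s (F₀ ccl r)} (l : R.Into r) → mapInto ccl l ≡ (s , h) →
             (∀ {l′} → mapInto ccl l′ ≡ (s , h) → l ≡ l′) → .(m : Monotone h g f) → Lifts g h m
      lift {g = g} (r₀ , k) refl unique m =
        (labelled r₀ g tt , labelledHom k m) , refl ,
        λ {y} e → injective y (unique (cong (mapInto (forget idF (Any idF))) e)) e

    -- F[ Pγ ] only needs the diagram and the fibration cclγ; two-sidedness of
    -- (premγ , q) is not used.
    Pγ : Diagram Jdgγ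
    Pγ = record { I = γ.∫ar ; J = Rγ ; s = premγ ; q = γ.q-ar ; t = cclγ ; t-fibration = cclγ-fibration }

    uγ : Functor Jdgγ Jdg
    uγ = forget idF (Any idF)

    u₂γ : Functor Rγ R
    u₂γ = forget ccl (Any ccl)

    uγ-morphism : VMorphism uγ Pγ diagram
    uγ-morphism = record
      { u₁       = u₁γ
      ; u₂       = u₂γ
      ; s-square = functor-≡ (λ _ → refl) (λ _ → refl)
      ; q-square = functor-≡ (λ _ → refl) (λ _ → refl)
      ; pullback = record
          { commutes = functor-≡ (λ _ → refl) (λ _ → refl)
          ; objects  = λ { (labelled _ f _) r refl →
              labelled r f tt , (refl , refl) , λ { {labelled _ _ _} (refl , refl) → refl } }
          ; arrows   = λ { (labelled _ f _ , labelled _ g _ , labelledHom _ m) (r₁ , r₂ , h) refl →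
              (labelled r₁ f tt , labelled r₂ g tt , labelledHom h m) , (refl , refl) ,
              λ { {labelled _ _ _ , labelled _ _ _ , labelledHom _ _} (refl , refl) → refl } } } }

    Alg-uγ : ∀ A → Algebra Pγ A → Algebra diagram ((uγ ₊) A)
    Alg-uγ = Mate.Alg uγ-morphism

{-# OPTIONS --safe #-}

-- Under u^* ⊣ u_*, solutions of c in Alg(u_*)(a′) correspond to solutions of
-- Coalg(u^*)(c) in a′.  The latter coalgebra is well-founded: an infinite path in
-- it is an infinite path of c whose nodes carry ordinal labels that never increase
-- along a trace and drop at each progressing step, which contradicts the global
-- trace condition.  A well-founded coalgebra has a unique solution in any algebra.

module Submission where

open import Axiom.ExcludedMiddle using (ExcludedMiddle)
open import Defs
open Theory
open import Data.Nat.Base as ℕ using (ℕ)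
open import Data.Nat.Properties using (≤⇒≤′)
open import Data.Product.Base using (Σ-syntax; ∃; ∃-syntax; _×_; _,_; proj₁; proj₂; map₂)
open import Data.Unit.Polymorphic.Base using (tt)
open import Induction.InfiniteDescent using (InfiniteDescendingSequence)
open import Induction.WellFounded using (WellFounded; Acc; acc)
open import Relation.Binary.Core using (Rel)
open import Relation.Binary.PropositionalEquality.Core using (_≡_; refl; sym; trans; cong; subst)
open import Relation.Binary.PropositionalEquality.Properties using (module ≡-Reasoning)
open import Relation.Nullary.Decidable using (decidable-stable; recompute)
open import Relation.Nullary.Negation using (¬_)

open ≡-Reasoning
open Category using (Obj; Hom; eqHom)
open Functor using (F₀; F₁)

-- Unique solutions of well-founded coalgebras.

module _ {ℓ} ⦃ funExt : FunExt ℓ ⦄ {A : SmallCategory} (D : Diagram A) where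

  open Diagram D

  F[]₁-cong : ∀ {X Y : Presheaf A} {f g : X ⇒ Y} → f ≈ g → F[ D ]₁ f ≈ F[ D ]₁ g
  F[]₁-cong {Y = Y} f≈g b (j , p , y) =
    cong (λ n → j , p , n) (Ran-≡ q ((s ^*) Y) λ i k → f≈g _ (fam y i k))

  module _ {C : Presheaf A} (c : Coalgebra D C) where

    -- Accessibility for the child relation. Children are taken at every `k : q i → j`, since `Ran`
    -- indexes families that way.
    data Founded : ∀ b → El C b → Set ℓ where
      founded : ∀ {b x} → (∀ i k → Founded (F₀ s i) (fam (proj₂ (proj₂ (at c b x))) i k)) → Founded b x

    module _ {Ω : Presheaf A} (a : Algebra D Ω) where

      -- The graph of the solution.  As a relation it is natural without any
      -- induction, so its values at the children of a node form a compatible family.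
      data Evaluates : ∀ b → El C b → El Ω b → Set ℓ where
        evaluates : ∀ {b x j p y m} → at c b x ≡ (j , p , y) →
                    (∀ i k → Evaluates (F₀ s i) (fam y i k) (fam m i k)) →
                    Evaluates b x (at a b (j , p , m))

      -- Restriction along `f` reindexes a family by composition with the lift of `f`, so the
      -- children of the restricted node already occur among those of `x`.
      evaluates-res : ∀ {b b′ x v} (f : Category.Hom A b′ b) →
                      Evaluates b x v → Evaluates b′ (res C f x) (res Ω f v)
      evaluates-res {x = x} f (evaluates {p = p} e children) =
        subst (Evaluates _ _) (natural a f _)
          (evaluates (trans (natural c f x) (cong (lan-map t t-fibration ((q ₊) ((s ^*) C)) f) e))
            (λ i k → children i (Category._∘_ J (Lift.lift t t-fibration f p) k)))

      evaluates-unique : ∀ {b x v w} → Evaluates b x v → Evaluates b x w → v ≡ w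
      evaluates-unique {b} (evaluates {j = j} {p} e children) (evaluates e′ children′)
        with refl ← trans (sym e) e′ =
        cong (λ n → at a b (j , p , n))
          (Ran-≡ q ((s ^*) Ω) λ i k → evaluates-unique (children i k) (children′ i k))

      evaluate : ∀ {b x} → Founded b x → ∃ (Evaluates b x)
      evaluate {b} {x} (founded children) = _ , evaluates {y = y} {m} refl (λ i k → proj₂ (evaluate (children i k)))
        where
        y = proj₂ (proj₂ (at c b x))
        m : Ran q ((s ^*) Ω) (proj₁ (at c b x))
        m = record
          { fam        = λ i k → proj₁ (evaluate (children i k))
          -- By compatibility of `y`, restricting the value at `i′` along `g` gives a value of the
          -- child at `i`, and that child has only one.
          ; compatible = λ {i} {i′} g k → evaluates-unique
              (subst (λ z → Evaluates (F₀ s i) z (res Ω (F₁ s g) (proj₁ (evaluate (children i′ k))))) (compatible y g k)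
                (evaluates-res (F₁ s g) (proj₂ (evaluate (children i′ k)))))
              (proj₂ (evaluate (children i _))) }

      -- The solution equation at `x` is one application of `evaluates`, with the values of `h` at
      -- the children as family.
      solution-evaluates : ∀ {h} → IsSolution D C Ω c a h → ∀ {b x} → Founded b x → Evaluates b x (at h b x)
      solution-evaluates {h} sol {b} {x} (founded children) =
        subst (Evaluates b x) (sym (IsSolution.equation sol b x))
          (evaluates refl (λ i k → solution-evaluates sol (children i k)))

      uniqueSolution : (∀ b x → Founded b x) → HasUniqueSolution D C Ω c a
      uniqueSolution wf =
        h ,
        record { equation = λ b x → evaluates-unique (value b x) (evaluates refl (λ i k → value _ _)) } ,
        λ sol b x → evaluates-unique (value b x) (solution-evaluates sol (wf b x))
        where
        value : ∀ b x → Evaluates b x (proj₁ (evaluate (wf b x)))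
        value b x = proj₂ (evaluate (wf b x))
        h : C ⇒ Ω
        h = record
          { at      = λ b x → proj₁ (evaluate (wf b x))
          ; natural = λ f x → evaluates-unique (value _ _) (evaluates-res f (value _ _)) }

-- Transposition of solutions along the adjunction of `u ^*` and `u ₊`.

module _ {ℓ} ⦃ funExt : FunExt ℓ ⦄ {A′ A : SmallCategory} {u : Functor A′ A} {D′ : Diagram A′} {D : Diagram A}
         (M : VMorphism u D′ D) where

  open Mate M
  private
    module A  = Category A
    module A′ = Category A′
    module D  = Diagram D
    module D′ = Diagram D′

  module _ {C : Presheaf A} {Ω : Presheaf A′} where

    infix 10 _♭ _♯
    _♭ : C ⇒ (u ₊) Ω → (u ^*) C ⇒ Ω
    h ♭ = counit u Ω ∙ (u ^*₁) h

    _♯ : (u ^*) C ⇒ Ω → C ⇒ (u ₊) Ω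
    k ♯ = (u ₊₁) k ∙ unit u C

    ♯♭ : (k : (u ^*) C ⇒ Ω) → k ♯ ♭ ≈ k
    ♯♭ k i x = cong (at k i) (res-id C x)

    -- Naturality of `h` turns evaluation at `f` into evaluation at the identity, so `h` is
    -- recovered from `h ♭`.
    fam-♭ : (h : C ⇒ (u ₊) Ω) → ∀ {b} x i (f : A.Hom (F₀ u i) b) →
            at (h ♭) i (res C f x) ≡ fam (at h b x) i f
    fam-♭ h x i f = trans (cong (λ n → fam n i A.id) (natural h f x)) (cong (fam (at h _ x) i) (A.idʳ f))

    -- Naturality of `τ` in the presheaf. The choice of `j′` depends on `j` alone, which `F[ D ]₁ h`
    -- preserves, so only families are compared.
    τ-♭ : (h : C ⇒ (u ₊) Ω) → ∀ i z →
          at (F[ D′ ]₁ (counit u Ω)) i (τ-at ((u ₊) Ω) i (at (F[ D ]₁ h) (F₀ u i) z)) ≡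
          at (F[ D′ ]₁ (h ♭)) i (τ-at C i z)
    τ-♭ h i (j , p , y) = cong (λ n → j′ , over , n)
      (Ran-≡ D′.q ((D′.s ^*) Ω) λ i′ k → cong (λ n → fam n _ A.id) (sym (natural h _ _)))
      where
      lifted = IsPullback.objects (VMorphism.pullback M) i j (sym p)
      j′ = proj₁ lifted
      over = proj₁ (proj₁ (proj₂ lifted))

    module _ (c : Coalgebra D C) (a : Algebra D′ Ω) where

      -- The unit inside `σ` restricts along `f`; naturality of `F[ D ]₁ h ∙ c` moves this
      -- restriction onto `x`, and `τ-♭` does the rest.
      fam-Alg : (h : C ⇒ (u ₊) Ω) → ∀ {b} x i (f : A.Hom (F₀ u i) b) →
                fam (at (Alg Ω a ∙ F[ D ]₁ h ∙ c) b x) i f ≡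
                at (a ∙ F[ D′ ]₁ (h ♭) ∙ Coalg C c) i (res C f x)
      fam-Alg h x i f = cong (at a i) (trans
        (cong (λ z → at (F[ D′ ]₁ (counit u Ω)) i (τ-at ((u ₊) Ω) i z)) (sym (natural (F[ D ]₁ h ∙ c) f x)))
        (τ-♭ h i (at c (F₀ u i) (res C f x))))

      transpose : HasUniqueSolution D′ ((u ^*) C) Ω (Coalg C c) a →
                  HasUniqueSolution D C ((u ₊) Ω) c (Alg Ω a)
      transpose (k , sol , unique) =
        k ♯ ,
        -- At `(i , f)` this is the equation of `k` at `res C f x`, with `k` rewritten as `k ♯ ♭` to
        -- fit `fam-Alg`.
        record { equation = λ b x → Ran-≡ u Ω λ i f → trans
          (trans (IsSolution.equation sol i (res C f x))
                 (cong (at a i) (sym (F[]₁-cong D′ {f = k ♯ ♭} {k} (♯♭ k) i (at (Coalg C c) i (res C f x))))))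
          (sym (fam-Alg (k ♯) x i f)) } ,
        λ {h} sol′ b x → Ran-≡ u Ω λ i f → trans (unique (♭-solution h sol′) i (res C f x)) (fam-♭ h x i f)
        where
        ♭-solution : ∀ h → IsSolution D C ((u ₊) Ω) c (Alg Ω a) h →
                     IsSolution D′ ((u ^*) C) Ω (Coalg C c) a (h ♭)
        ♭-solution h sol′ = record { equation = λ i x → trans
          (cong (λ n → fam n i A.id) (IsSolution.equation sol′ (F₀ u i) x))
          (trans (fam-Alg h x i A.id)
                 (cong (at (a ∙ F[ D′ ]₁ (h ♭) ∙ Coalg C c) i) (res-id C x))) }

-- Classical well-foundedness from the absence of infinite descent.

module _ {ℓ} (em : ExcludedMiddle ℓ) {A : Set ℓ} {_<_ : Rel A ℓ} where

  -- Excluded middle on types returns an actual predecessor as a function of the proof of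
  -- non-accessibility, which stands in for dependent choice.
  ¬acc⇒¬acc-below : ∀ {x} → ¬ Acc _<_ x → ∃[ y ] y < x × ¬ Acc _<_ y
  ¬acc⇒¬acc-below ¬acc = decidable-stable em λ none →
    ¬acc (acc λ y<x → decidable-stable em λ ¬acc-y → none (_ , y<x , ¬acc-y))

  ¬acc⇒infiniteDescent : ∀ {x} → ¬ Acc _<_ x → ∃ (InfiniteDescendingSequence _<_)
  ¬acc⇒infiniteDescent {x} ¬acc = (λ k → proj₁ (f k)) , λ k → proj₁ (proj₂ (¬acc⇒¬acc-below (proj₂ (f k))))
    where
    f : ℕ → Σ[ y ∈ A ] ¬ Acc _<_ y
    f ℕ.zero    = x , ¬acc
    f (ℕ.suc k) = map₂ proj₂ (¬acc⇒¬acc-below (proj₂ (f k)))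

  noInfiniteDescent⇒wellFounded : (∀ f → ¬ InfiniteDescendingSequence _<_ f) → WellFounded _<_
  noInfiniteDescent⇒wellFounded noDescent x = decidable-stable em λ ¬acc →
    let (f , descending) = ¬acc⇒infiniteDescent ¬acc in noDescent f descending

-- Non-increasing sequences of ordinals.

module _ {ℓ} (γ : Ordinal ℓ) where

  open Ordinal γ

  antitone : ∀ (α : ℕ → Carrier) → (∀ k → α (ℕ.suc k) ≤ α k) → ∀ {m n} → m ℕ.≤′ n → α n ≤ α m
  antitone α dec (ℕ.≤′-reflexive refl) = ≤-reflexive refl
  antitone α dec (ℕ.≤′-step m≤n)       = ≤-trans (dec _) (antitone α dec m≤n)

  -- A drop at some `k ≥ N` lands below `α N`, because `α` does not rise in between; the search
  -- restarts at `ℕ.suc k`, by induction on accessibility.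
  noInfinitelyDecreasing : (α : ℕ → Carrier) → (∀ k → α (ℕ.suc k) ≤ α k) →
                           ¬ (∀ N → ∃[ k ] N ℕ.≤ k × α (ℕ.suc k) < α k)
  noInfinitelyDecreasing α dec drops = go 0 (wellFounded (α 0))
    where
    go : ∀ N → ¬ Acc _<_ (α N)
    go N (acc below) =
      let (k , N≤k , drop) = drops N
      in go (ℕ.suc k) (below (<-≤-trans drop (antitone α dec (≤⇒≤′ N≤k))))

-- Well-foundedness of the annotated pre-proof under the global trace condition.

module _ {ℓ} ⦃ funExt : FunExt ℓ ⦄ (em : ExcludedMiddle ℓ) {Jdg : SmallCategory}
         (P : ProofSystem Jdg) (t : TraceStructure P) (γ : Ordinal ℓ) {C : Presheaf Jdg} (c : PreProof P C) where

  open ProofSystem P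
  open LabelledGraph P c
  open TraceStructure t
  open Annotation P t γ
  open Ordinal γ using (_<_; _≤_)
  open LabelledObj
  open Mate uγ-morphism
  private
    module R   = Category R
    module Jdg = Category Jdg
    module Pγ  = Diagram Pγ

  AnnotatedJudgement : Set ℓ
  AnnotatedJudgement = Σ[ s ∈ Jdg.Obj ] Label s

  AnnotatedNode : Set ℓ
  AnnotatedNode = Σ[ x ∈ Node ] Label (proj₁ x)

  -- `Admissible` with both judgements left free, so that it can be carried along equations between
  -- judgements.
  Descends : Obj ∫ar → AnnotatedJudgement → AnnotatedJudgement → Set ℓ
  Descends ri (s , f) (s′ , g) = ∀ φ ψ →
    (Step ri (s , φ) (s′ , ψ) → g ψ ≤ f φ) × (Prog ri (s , φ) (s′ , ψ) → g ψ < f φ)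

  -- Taking an arbitrary `z` in place of `at c s n` allows the equation between the conclusion of
  -- its rule and `s` to be matched with `refl`.
  AnnotatedEdge : ∀ {s} → El (F[ diagram ] C) s → Label s → AnnotatedNode → Set ℓ
  AnnotatedEdge {s} (r , _ , y) f (x , g) = Σ[ i ∈ Obj (Ar r) ]
    x ≡ (F₀ prem (r , i) , fam y (r , i) R.id) × Descends (r , i) (s , f) (proj₁ x , g)

  infix 4 _≺_
  _≺_ : Rel AnnotatedNode ℓ
  y ≺ ((s , n) , f) = AnnotatedEdge (at c s n) f y

  noInfiniteAnnotatedPath : GlobalTraceCondition t → ∀ x → ¬ InfiniteDescendingSequence _≺_ x
  noInfiniteAnnotatedPath gtc x edges =
    let (m , trace , progressing) = gtc path
        open Trace trace
    -- The ordinals are those that the labels assign to the trace formulas; the shift by `m` passes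
    -- to the suffix carrying the trace.
    in noInfinitelyDecreasing γ (λ k → proj₂ (x (k ℕ.+ m)) (formula k))
         (λ k → proj₁ (descends (k ℕ.+ m) _ _) (step k))
         (λ N → let (k , N≤k , prog) = progressing N in k , N≤k , proj₂ (descends (k ℕ.+ m) _ _) prog)
    where
    path : Path
    path = record
      { node  = λ k → proj₁ (x k)
      ; label = λ k → proj₁ (edges k)
      ; edge  = λ k → proj₁ (proj₂ (edges k)) }
    descends = λ k → proj₂ (proj₂ (edges k))

  node-≡ : ∀ {s s′} (e : s ≡ s′) {m : El C s} {n} → res C (eqHom Jdg e) n ≡ m → _≡_ {A = Node} (s , m) (s′ , n)
  node-≡ {s} refl {n = n} refl =
    cong (s ,_) (trans (cong (λ h → res C h n) (Jdg.eqHom-id refl)) (res-id C n))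

  descends-relabel : ∀ {ri s s′} {f : Label s} {g : Label s′} {s″} (e : s′ ≡ s″) →
                     Descends ri (s , f) (s″ , relabel e g) → Descends ri (s , f) (s′ , g)
  descends-relabel refl d = d

  -- Families are indexed by all k : q i → j, not only by the fibre over j; by
  -- opcartesian transport the component at (i , h) is the child at ar(h)(i).
  annotatedEdge : ∀ {s} (f : Label s) (z : El (F[ diagram ] C) s) i
                  (k : Hom Rγ (F₀ Pγ.q i) (proj₁ (τ-at C (labelled s f tt) z))) →
                  AnnotatedEdge z f
                    ((F₀ prem (F₀ u₁γ i) , fam (proj₂ (proj₂ (τ-at C (labelled s f tt) z))) i k) , label (proj₂ i))
  annotatedEdge f (r , refl , y) i₀@(labelled r₁ f₁ _ , labelled i g adm) k₀@(labelledHom h m) =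
    ar₀ h i ,
    node-≡ (prem-≡ h i) (begin
      res C (eqHom Jdg (prem-≡ h i)) (fam y (r , ar₀ h i) R.id)
        ≡⟨ cong (λ k → res C k (fam y (r , ar₀ h i) R.id)) (sym (prem-eqHom h i)) ⟩
      res C (F₁ prem (opcartesian h i)) (fam y (r , ar₀ h i) R.id)
        ≡⟨ compatible y (opcartesian h i) R.id ⟩
      fam y (r₁ , i) (R.id R.∘ h)
        ≡⟨ cong (fam y (r₁ , i)) (trans (R.idˡ h) (sym along-≡)) ⟩
      fam y (r₁ , i) (along refl k₀)
        ≡⟨ sym (trans (cong (λ k → res C k (fam y (r₁ , i) (along refl k₀))) (Jdg.eqHom-id _)) (res-id C _)) ⟩
      fam (proj₂ (proj₂ (τ-at C (labelled (F₀ ccl r) f tt) (r , refl , y)))) i₀ k₀ ∎) ,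
    descends-relabel (prem-≡ h i)
      -- `m` and `adm` are irrelevant fields; excluded middle recovers usable proofs of them.
      (push-admissible h {f₁} {f} (recompute em m) i g (recompute em adm))
    where
    along-≡ : along {i₀} refl k₀ ≡ h
    along-≡ = trans (R.∘-congˡ (R.eqHom-id _)) (trans (R.idʳ _) (trans (R.∘-congʳ (R.eqHom-id refl)) (R.idˡ h)))

  -- By `annotatedEdge` each child in `Coalg C c` lies below its parent for `_≺_`, so accessibility
  -- transfers.
  founded-below : ∀ {s n f} → Acc _≺_ ((s , n) , f) → Founded Pγ (Coalg C c) (labelled s f tt) n
  founded-below {s} {n} {f} (acc below) = founded λ i k → founded-below (below (annotatedEdge f (at c s n) i k))

theorem4p13 : ∀ {ℓ} ⦃ funExt : FunExt ℓ ⦄ (em : ExcludedMiddle ℓ)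
    {Jdg : SmallCategory} (P : ProofSystem Jdg) (t : TraceStructure P) (γ : Ordinal ℓ)
    {C : Presheaf Jdg} (c : PreProof P C) →
    LabelledGraph.GlobalTraceCondition P c t →
    let open Annotation P t γ in
    {A : Presheaf Jdgγ} (a′ : Algebra Pγ A) →
    HasUniqueSolution (ProofSystem.diagram P) C ((uγ ₊) A) c (Alg-uγ A a′)
theorem4p13 em P t γ {C} c gtc a′ =
  transpose uγ-morphism c a′ (uniqueSolution Pγ _ a′ λ { (labelled s f _) n →
    founded-below em P t γ c (noInfiniteDescent⇒wellFounded em (noInfiniteAnnotatedPath em P t γ c gtc) _) })
  where
  open Annotation P t γ
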